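{- Let $\mathcal{O}$ be a Euclidean oriented matroid on ground set $E$ and let $\mathcal{O}\cup p$ be a lexicographic extension of $\mathcal{O}$. Then for every $f\in E$ such that $(\mathcal{O}\cup p,p,f)$ is an oriented matroid program, $(\mathcal{O}\cup p,p,f)$ is a Euclidean oriented matroid program.
   Context: An oriented matroid $\mathcal{O}$ on a finite ground set $E$ is given by its set of covectors in $\{+,-,0\}^E$; cocircuits are the minimal nonzero covectors. For a sign vector $X$, $X_e$ is its $e$-entry, $\mathrm{supp}(X)=\{e:X_e\neq 0\}$, $z(X)=E\setminus \mathrm{supp}(X)$, $(X\circ Y)_e=X_e$ if $X_e\ne0$ and $Y_e$ otherwise, $\mathrm{sep}(X,Y)=\{e: X_e=-Y_e\neq 0\}$; $X,Y$ are conformal if $\mathrm{sep}(X,Y)=\emptyset$. Let $r$ be the rank of the underlying matroid $\mathcal{M}(\mathcal{O})$. Two cocircuits $X\neq\pm Y$ are comodular if $z(X),z(Y)$ form a modular pair in $\mathcal{M}(\mathcal{O})$, equivalently $z(X\circ Y)$ is a flat of rank $r-2$. For comodular $X,Y$ and $e\in\mathrm{sep}(X,Y)$, cocircuit elimination of $e$ between $X$ and $Y$ yields the unique cocircuit $Z$ with $Z_e=0$ and $\mathrm{supp}(Z)\subseteq \mathrm{supp}(X\circ Y)\setminus\{e\}$. An oriented matroid program $(\mathcal{O},g,f)$ consists of $\mathcal{O}$ and distinct $g,f\in E$ with $g$ not a loop and $f$ not a coloop. For comodular cocircuits $X,Y$ with $X_g=Y_g\neq0$ let $Z$ be obtained by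 elimination of $g$ between $-X$ and $Y$; write $X\to Y$ if $Z_f=+$, $X\leftarrow Y$ if $Z_f=-$, and $X\leftrightarrow Y$ (undirected) if $Z_f=0$. The graph $G_f$ of $(\mathcal{O},g,f)$ has as vertices the cocircuits $Y$ with $Y_g=+$, and an edge between any two conformal comodular cocircuits, directed as just described. A directed cycle in $G_f$ is a sequence $P^1,\dots,P^n=P^1$ with $P^1,\dots,P^{n-1}$ pairwise distinct, consecutive entries adjacent, $P^i\to P^{i+1}$ or $P^i\leftrightarrow P^{i+1}$ for all $i$, and not all edges undirected. $(\mathcal{O},g,f)$ is Euclidean if $G_f$ has no directed cycle; $\mathcal{O}$ is Euclidean if every program $(\mathcal{O},g,f)$ ($g\neq f$, $g$ not a loop, $f$ not a coloop) is Euclidean. For an ordered subset $I=[e_1,\dots,e_k]$ of $E$ and $\alpha\in\{+,-\}^k$, the lexicographic extension $\mathcal{O}[e_1^{\alpha_1},\dots,e_k^{\alpha_k}]=\mathcal{O}\cup p$ is the single-element extension by a new element $p$ with localization $\sigma(Y)=\alpha_iY_{e_i}$ on cocircuits $Y$, where $i$ is the smallest index with $Y_{e_i}\neq 0$, and $\sigma(Y)=0$ if $Y_{e_1}=\dots=Y_{e_k}=0$. -}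

module Defs where

open import Data.Nat using (ℕ; zero; suc; _+_; _≤_)
open import Data.Fin using (Fin; zero; suc; inject₁; fromℕ)
open import Data.Fin.Subset using (Subset; _⊆_; _⊂_; ⁅_⁆)
open import Data.Vec using (Vec; []; _∷_; lookup; map; zipWith; replicate)
open import Data.Bool using (Bool; true; false; not)
open import Data.List using (List; []; _∷_)
open import Data.Product using (Σ; ∃; ∃-syntax; _×_; _,_; proj₁; proj₂)
open import Data.Sum using (_⊎_)
open import Relation.Nullary using (¬_)
open import Relation.Binary.PropositionalEquality using (_≡_; _≢_)

data Sign : Set where
  pos neg zer : Sign

-ₛ_ : Sign → Sign
-ₛ pos = neg
-ₛ neg = pos
-ₛ zer = zer

_∘ₛ_ : Sign → Sign → Sign
zer ∘ₛ t = t
pos ∘ₛ t = pos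
neg ∘ₛ t = neg

_*ₛ_ : Sign → Sign → Sign
zer *ₛ t = zer
pos *ₛ t = t
neg *ₛ t = -ₛ t

isZero : Sign → Bool
isZero zer = true
isZero pos = false
isZero neg = false

SV : ℕ → Set
SV n = Vec Sign n

𝟎 : ∀ {n} → SV n
𝟎 {n} = replicate n zer

negV : ∀ {n} → SV n → SV n
negV = map -ₛ_

_∘_ : ∀ {n} → SV n → SV n → SV n
_∘_ = zipWith _∘ₛ_

z : ∀ {n} → SV n → Subset n
z = map isZero

supp : ∀ {n} → SV n → Subset n
supp X = map (λ s → not (isZero s)) X

Sep : ∀ {n} → SV n → SV n → Fin n → Set
Sep X Y e = (lookup X e ≢ zer) × (lookup X e ≡ -ₛ lookup Y e)

Conformal : ∀ {n} → SV n → SV n → Set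
Conformal X Y = ∀ e → ¬ Sep X Y e

data _≼_ : Sign → Sign → Set where
  zer≼ : ∀ {s} → zer ≼ s
  refl≼ : ∀ {s} → s ≼ s

_≼ᵥ_ : ∀ {n} → SV n → SV n → Set
Y ≼ᵥ X = ∀ e → lookup Y e ≼ lookup X e

record OrientedMatroid (n : ℕ) : Set₁ where
  field
    Cov      : SV n → Set
    cov-zero : Cov 𝟎
    cov-neg  : ∀ {X} → Cov X → Cov (negV X)
    cov-comp : ∀ {X Y} → Cov X → Cov Y → Cov (X ∘ Y)
    cov-elim : ∀ {X Y} → Cov X → Cov Y → ∀ e → Sep X Y e →
               ∃[ Z ] (Cov Z × lookup Z e ≡ zer ×
                       (∀ f → ¬ Sep X Y f → lookup Z f ≡ lookup (X ∘ Y) f))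

open OrientedMatroid public

module _ {n : ℕ} (O : OrientedMatroid n) where

  Cocircuit : SV n → Set
  Cocircuit X = Cov O X × X ≢ 𝟎 ×
                (∀ Y → Cov O Y → Y ≢ 𝟎 → Y ≼ᵥ X → Y ≡ X)

  Loop : Fin n → Set
  Loop e = ∀ X → Cov O X → lookup X e ≡ zer

  Coloop : Fin n → Set
  Coloop e = ∃[ X ] (Cocircuit X × supp X ≡ ⁅ e ⁆)

  -- flats of the underlying matroid M(O) are the zero sets of covectors
  Flat : Subset n → Set
  Flat A = ∃[ X ] (Cov O X × z X ≡ A)

  data Chain : Subset n → Subset n → ℕ → Set where
    done : ∀ {A} → Flat A → Chain A A 0
    step : ∀ {A B C k} → Flat A → A ⊂ B → Chain B C k → Chain A C (suc k)

  -- rank of a flat F in M(O): its height in the lattice of flats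
  -- (length of a longest chain of flats ending in F)
  HasRank : Subset n → ℕ → Set
  HasRank F k = (∃[ A ] Chain A F k) × (∀ A m → Chain A F m → m ≤ k)

  Full : Subset n
  Full = z (𝟎 {n})

  Comodular : SV n → SV n → Set
  Comodular X Y = Cocircuit X × Cocircuit Y × X ≢ Y × X ≢ negV Y ×
                  ∃[ r ] ∃[ k ] (HasRank Full r × HasRank (z (X ∘ Y)) k × k + 2 ≡ r)

  Elim : SV n → SV n → Fin n → SV n → Set
  Elim X Y e Z = Cocircuit Z × lookup Z e ≡ zer ×
                 (∀ h → lookup Z h ≢ zer →
                   (lookup Z h ≡ lookup X h) ⊎ (lookup Z h ≡ lookup Y h))

  Program : Fin n → Fin n → Set
  Program g f = g ≢ f × ¬ Loop g × ¬ Coloop f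

  module _ (g f : Fin n) where

    Vertex : SV n → Set
    Vertex Y = Cocircuit Y × lookup Y g ≡ pos

    Adjacent : SV n → SV n → Set
    Adjacent X Y = Conformal X Y × Comodular X Y

    Arrow : SV n → SV n → Set
    Arrow X Y = ∃[ Z ] (Elim (negV X) Y g Z × lookup Z f ≡ pos)

    Undirected : SV n → SV n → Set
    Undirected X Y = ∃[ Z ] (Elim (negV X) Y g Z × lookup Z f ≡ zer)

    Step : SV n → SV n → Set
    Step X Y = Adjacent X Y × (Arrow X Y ⊎ Undirected X Y)

    -- a directed cycle P¹,…,Pⁿ = P¹ in G_f; here P (i : Fin (suc m)) are
    -- the pairwise distinct P¹,…,Pⁿ⁻¹ (n - 1 = suc m)
    record DirectedCycle : Set where
      field
        m        : ℕ
        P        : Fin (suc m) → SV n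
        distinct : ∀ i j → P i ≡ P j → i ≡ j
        vertex   : ∀ i → Vertex (P i)
        steps    : ∀ (i : Fin m) → Step (P (inject₁ i)) (P (suc i))
        closing  : Step (P (fromℕ m)) (P zero)
        directed : (∃[ i ] Arrow (P (inject₁ i)) (P (suc i)))
                   ⊎ Arrow (P (fromℕ m)) (P zero)

    EuclideanProgram : Set
    EuclideanProgram = ¬ DirectedCycle

  Euclidean : Set
  Euclidean = ∀ g f → Program g f → EuclideanProgram g f

-- Single-element extensions.  The extension O ∪ p lives on Fin (suc n),
-- the new element p is index zero, and e ∈ E corresponds to suc e.

IsExtension : ∀ {n} → OrientedMatroid (suc n) → OrientedMatroid n →
              (SV n → Sign) → Set
IsExtension {n} Õ O σ =
  -- deleting p from O ∪ p gives O
  (∀ X → (Cov O X → ∃[ s ] Cov Õ (s ∷ X)) × (∃[ s ] Cov Õ (s ∷ X) → Cov O X))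
  × (∀ Y → Cocircuit O Y → Cov Õ (σ Y ∷ Y))

-- lexicographic localization for I = [e₁,…,e_k], α ∈ {+,-}^k,
-- given as the list [(e₁,α₁),…,(e_k,α_k)]
lexσ : ∀ {n} → List (Fin n × Sign) → SV n → Sign
lexσ [] Y = zer
lexσ ((e , a) ∷ I) Y with lookup Y e
... | zer = lexσ I Y
... | s   = a *ₛ s

{-# OPTIONS --safe #-}
module Submission where

open import Defs
open import Data.Bool using (true; false; not)
open import Data.Empty using (⊥; ⊥-elim)
open import Data.Nat using (ℕ; zero; suc; _+_; _≤_)
open import Data.Nat.Properties using (+-comm; ≤-trans; ≤-reflexive; 1+n≰n)
open import Data.Fin using (Fin; zero; suc; inject₁; fromℕ; opposite)
open import Data.Fin.Properties using (any?; opposite-involutive)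
open import Data.Fin.Induction using (<-weakInduction; >-weakInduction)
open import Data.Fin.Relation.Unary.Top using (view; view-fromℕ; view-inject₁; ‵fromℕ; ‵inject₁)
open import Data.Fin.Subset using (_∈_; _⊆_; _⊂_)
open import Data.Fin.Subset.Properties using (drop-there; drop-∷-⊂; x∈⁅y⁆⇒x≡y)
open import Data.List using (List; []; _∷_; map; allFin)
open import Data.List.Membership.Propositional using () renaming (_∈_ to _∈ₗ_)
open import Data.List.Membership.Propositional.Properties using (∈-allFin)
open import Data.List.Relation.Unary.All using (All; []; _∷_)
open import Data.List.Relation.Unary.Any using (here; there)
open import Data.List.Relation.Unary.Unique.Propositional using (Unique)
open import Data.Product using (∃-syntax; _×_; _,_; proj₁; proj₂)
open import Data.Sum using (_⊎_; inj₁; inj₂; [_,_]′)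
open import Data.Vec using ([]; _∷_; lookup; tail; here; there)
open import Data.Vec.Properties using (≡-dec; lookup-map; lookup-zipWith; lookup-replicate; map-replicate; lookup⇒[]=; []=⇒lookup; tabulate∘lookup; tabulate-cong; ∷-injectiveʳ)
open import Function using (case_of_)
open import Relation.Binary.Definitions using (DecidableEquality)
open import Relation.Nullary using (¬_; yes; no; contradiction)
open import Relation.Nullary.Decidable using (¬?; _×-dec_; decidable-stable)
open import Relation.Binary.PropositionalEquality using (_≡_; _≢_; refl; sym; trans; cong; cong₂; subst; subst₂)

-- Let P¹, …, Pⁿ be a directed cycle of (O ∪ p, p, f).  Along an edge with p-eliminated
-- cocircuit Z, Z_f ≥ 0 forces the sign of f to be monotone, so f is constant on the cycle,
-- with value c ≠ 0 (if c = 0, all edges are undirected).  Let e be the first element of I not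
-- vanishing on the whole cycle, with sign a.  Since p lies infinitesimally close to e, an edge
-- between {e = 0} and {e ≠ 0} has Z_f = c when leaving {e ≠ 0} and Z_f = −c when entering it;
-- so the cycle does not meet both, and P_e = a throughout.  If Z′ eliminates e on an edge of O, then
-- Z_f = Z′_f when Z′_f ≠ 0, and Z_f = −c σ(Z′) otherwise.  Hence the same cycle, up to
-- reversal and negation, is directed in (O, e, f) or, if Z′_f = 0 on all edges, in (O, e, e_j)
-- for the first e_j not vanishing on all Z′; both contradict that O is Euclidean.

private variable
  n : ℕ
  s t : Sign

-- Arithmetic of signs.

infix 4 _≟_
_≟_ : DecidableEquality Sign
pos ≟ pos = yes refl
pos ≟ neg = no λ ()
pos ≟ zer = no λ ()
neg ≟ pos = no λ ()
neg ≟ neg = yes refl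
neg ≟ zer = no λ ()
zer ≟ pos = no λ ()
zer ≟ neg = no λ ()
zer ≟ zer = yes refl

-ₛ-involutive : ∀ s → -ₛ (-ₛ s) ≡ s
-ₛ-involutive pos = refl
-ₛ-involutive neg = refl
-ₛ-involutive zer = refl

-ₛ≡zer : -ₛ s ≡ zer → s ≡ zer
-ₛ≡zer {zer} _ = refl

≡-ₛ⇒≡zer : s ≡ -ₛ s → s ≡ zer
≡-ₛ⇒≡zer {zer} _ = refl

≢⇒≡-ₛ : s ≢ zer → t ≢ zer → s ≢ t → s ≡ -ₛ t
≢⇒≡-ₛ {pos} {pos} _ _ p = contradiction refl p
≢⇒≡-ₛ {pos} {neg} _ _ _ = refl
≢⇒≡-ₛ {neg} {pos} _ _ _ = refl
≢⇒≡-ₛ {neg} {neg} _ _ p = contradiction refl p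
≢⇒≡-ₛ {zer} p _ _ = contradiction refl p
≢⇒≡-ₛ {_} {zer} _ p _ = contradiction refl p

≢neg⇒≡pos : s ≢ zer → s ≢ neg → s ≡ pos
≢neg⇒≡pos {pos} _ _ = refl
≢neg⇒≡pos {neg} _ q = contradiction refl q
≢neg⇒≡pos {zer} q _ = contradiction refl q

∘ₛ-zerˡ : s ≡ zer → s ∘ₛ t ≡ t
∘ₛ-zerˡ refl = refl

∘ₛ-zerʳ : t ≡ zer → s ∘ₛ t ≡ s
∘ₛ-zerʳ {s = pos} _ = refl
∘ₛ-zerʳ {s = neg} _ = refl
∘ₛ-zerʳ {s = zer} p = p

∘ₛ-nonzeroˡ : s ≢ zer → s ∘ₛ t ≡ s
∘ₛ-nonzeroˡ {pos} _ = refl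
∘ₛ-nonzeroˡ {neg} _ = refl
∘ₛ-nonzeroˡ {zer} p = contradiction refl p

∘ₛ≡zer : s ∘ₛ t ≡ zer → s ≡ zer × t ≡ zer
∘ₛ≡zer {zer} p = refl , p

*ₛ-nonzero : s ≢ zer → t ≢ zer → s *ₛ t ≢ zer
*ₛ-nonzero {pos} _ q = q
*ₛ-nonzero {neg} _ q = λ p → q (-ₛ≡zer p)
*ₛ-nonzero {zer} p _ = contradiction refl p

*ₛ-zerʳ : ∀ s → s *ₛ zer ≡ zer
*ₛ-zerʳ pos = refl
*ₛ-zerʳ neg = refl
*ₛ-zerʳ zer = refl

*ₛ-assoc : ∀ s t u → (s *ₛ t) *ₛ u ≡ s *ₛ (t *ₛ u)
*ₛ-assoc pos t u = refl
*ₛ-assoc neg pos u = refl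
*ₛ-assoc neg neg u = sym (-ₛ-involutive u)
*ₛ-assoc neg zer u = refl
*ₛ-assoc zer t u = refl

-ₛ-*ₛ-comm : ∀ s t → -ₛ (s *ₛ t) ≡ (-ₛ t) *ₛ s
-ₛ-*ₛ-comm pos pos = refl
-ₛ-*ₛ-comm pos neg = refl
-ₛ-*ₛ-comm pos zer = refl
-ₛ-*ₛ-comm neg pos = refl
-ₛ-*ₛ-comm neg neg = refl
-ₛ-*ₛ-comm neg zer = refl
-ₛ-*ₛ-comm zer pos = refl
-ₛ-*ₛ-comm zer neg = refl
-ₛ-*ₛ-comm zer zer = refl

-ₛ-*ₛ--ₛ : ∀ s t → (-ₛ s) *ₛ (-ₛ t) ≡ s *ₛ t
-ₛ-*ₛ--ₛ pos t = -ₛ-involutive t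
-ₛ-*ₛ--ₛ neg t = refl
-ₛ-*ₛ--ₛ zer t = refl

*ₛ≡pos⇒≡ : s *ₛ t ≡ pos → t ≡ s
*ₛ≡pos⇒≡ {pos} p = p
*ₛ≡pos⇒≡ {neg} {neg} _ = refl

≼-intro : (s ≢ zer → s ≡ t) → s ≼ t
≼-intro {zer} _ = zer≼
≼-intro {pos} p with refl ← p (λ ()) = refl≼
≼-intro {neg} p with refl ← p (λ ()) = refl≼

-- Sign vectors, conformality and zero sets.

infix 30 _!_
_!_ : SV n → Fin n → Sign
_!_ = lookup

_≟ᵥ_ : DecidableEquality (SV n)
_≟ᵥ_ = ≡-dec _≟_

!-ext : {X Y : SV n} → (∀ e → X ! e ≡ Y ! e) → X ≡ Y
!-ext {X = X} {Y} p = trans (sym (tabulate∘lookup X)) (trans (tabulate-cong p) (tabulate∘lookup Y))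

!-negV : ∀ (X : SV n) e → negV X ! e ≡ -ₛ (X ! e)
!-negV X e = lookup-map e -ₛ_ X

!-∘ : ∀ (X Y : SV n) e → (X ∘ Y) ! e ≡ (X ! e) ∘ₛ (Y ! e)
!-∘ X Y e = lookup-zipWith _∘ₛ_ e X Y

!-𝟎 : ∀ (e : Fin n) → 𝟎 ! e ≡ zer
!-𝟎 e = lookup-replicate e zer

!-nonzero⇒≢𝟎 : {X : SV n} → ∀ e → X ! e ≢ zer → X ≢ 𝟎
!-nonzero⇒≢𝟎 e p refl = p (!-𝟎 e)

≢𝟎⇒!-nonzero : {X : SV n} → X ≢ 𝟎 → ∃[ e ] X ! e ≢ zer
≢𝟎⇒!-nonzero {X = X} X≢𝟎 with any? (λ e → ¬? (X ! e ≟ zer))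
... | yes p = p
... | no ∄e = contradiction (!-ext λ e → trans (decidable-stable (X ! e ≟ zer) (λ p → ∄e (e , p))) (sym (!-𝟎 e))) X≢𝟎

negV-involutive : (X : SV n) → negV (negV X) ≡ X
negV-involutive X = !-ext λ e → trans (!-negV (negV X) e) (trans (cong -ₛ_ (!-negV X e)) (-ₛ-involutive (X ! e)))

negV-injective : {X Y : SV n} → negV X ≡ negV Y → X ≡ Y
negV-injective {X = X} {Y} p = trans (sym (negV-involutive X)) (trans (cong negV p) (negV-involutive Y))

negV-𝟎 : negV (𝟎 {n}) ≡ 𝟎
negV-𝟎 {n} = map-replicate -ₛ_ zer n

negV-≢𝟎 : {X : SV n} → X ≢ 𝟎 → negV X ≢ 𝟎
negV-≢𝟎 p q = p (negV-injective (trans q (sym negV-𝟎)))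

-- For covectors this is membership in the contraction at `z (X ∘ Y)`, which for comodular `X` and
-- `Y` is the line through them.
Above : SV n → SV n → SV n → Set
Above X Y W = ∀ h → X ! h ≡ zer → Y ! h ≡ zer → W ! h ≡ zer

conformal-sym : (X Y : SV n) → Conformal X Y → Conformal Y X
conformal-sym X Y cf e (p , q) = cf e ((λ x → p (trans q (cong -ₛ_ x))) , trans (sym (-ₛ-involutive (X ! e))) (cong -ₛ_ (sym q)))

conformal-neg : (X Y : SV n) → Conformal X Y → Conformal (negV X) (negV Y)
conformal-neg X Y cf e (p , q) = cf e ((λ x → p (trans (!-negV X e) (cong -ₛ_ x))) ,
  trans (sym (-ₛ-involutive (X ! e))) (cong -ₛ_ (trans (sym (!-negV X e)) (trans q (trans (cong -ₛ_ (!-negV Y e)) (-ₛ-involutive (Y ! e)))))))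

conformal-≡ : (X Y : SV n) → Conformal X Y → ∀ e → X ! e ≢ zer → Y ! e ≢ zer → X ! e ≡ Y ! e
conformal-≡ X Y cf e p q = decidable-stable (X ! e ≟ Y ! e) λ r → cf e (p , ≢⇒≡-ₛ p q r)

∈z⁺ : (X : SV n) → ∀ {e} → X ! e ≡ zer → e ∈ z X
∈z⁺ X {e} p = lookup⇒[]= e (z X) (trans (lookup-map e isZero X) (cong isZero p))

∈z⁻ : (X : SV n) → ∀ {e} → e ∈ z X → X ! e ≡ zer
∈z⁻ X {e} p = lemma (trans (sym (lookup-map e isZero X)) ([]=⇒lookup p))
  where
  lemma : isZero s ≡ true → s ≡ zer
  lemma {zer} _ = refl

z-⊂ : (X Y : SV n) → (∀ h → X ! h ≡ zer → Y ! h ≡ zer) → ∀ e → X ! e ≢ zer → Y ! e ≡ zer → z X ⊂ z Y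
z-⊂ X Y p e q r = (λ x → ∈z⁺ Y (p _ (∈z⁻ X x))) , e , ∈z⁺ Y r , λ x → q (∈z⁻ X x)

z-cong : (X Y : SV n) → (∀ h → X ! h ≡ zer → Y ! h ≡ zer) → (∀ h → Y ! h ≡ zer → X ! h ≡ zer) → z X ≡ z Y
z-cong [] [] p q = refl
z-cong (s ∷ X) (t ∷ Y) p q = cong₂ _∷_ (lemma (p zero) (q zero)) (z-cong X Y (λ h → p (suc h)) (λ h → q (suc h)))
  where
  lemma : ∀ {s t} → (s ≡ zer → t ≡ zer) → (t ≡ zer → s ≡ zer) → isZero s ≡ isZero t
  lemma {zer} p q = cong isZero (sym (p refl))
  lemma {pos} {zer} p q = cong isZero (q refl)
  lemma {neg} {zer} p q = cong isZero (q refl)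
  lemma {pos} {pos} p q = refl
  lemma {pos} {neg} p q = refl
  lemma {neg} {pos} p q = refl
  lemma {neg} {neg} p q = refl

-- Cocircuits, elimination and comodular pairs.

module _ (O : OrientedMatroid n) where

  -- At these three kinds of positions `X` and `Y` do not separate, so the axiom fixes `Z` as
  -- `X ∘ Y` there.
  elimination : ∀ {X Y} → Cov O X → Cov O Y → ∀ e → X ! e ≢ zer → X ! e ≡ -ₛ (Y ! e) →
    ∃[ Z ] (Cov O Z × Z ! e ≡ zer ×
      (∀ h → X ! h ≡ zer → Z ! h ≡ Y ! h) ×
      (∀ h → Y ! h ≡ zer → Z ! h ≡ X ! h) ×
      (∀ h → X ! h ≡ Y ! h → Z ! h ≡ X ! h))
  elimination {X} {Y} cX cY e p q with cov-elim O cX cY e (p , q)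
  ... | Z , cZ , Ze , rest = Z , cZ , Ze ,
    (λ h x → trans (rest h (λ k → proj₁ k x)) (trans (!-∘ X Y h) (∘ₛ-zerˡ x))) ,
    (λ h y → trans (rest h (λ k → proj₁ k (trans (proj₂ k) (cong -ₛ_ y)))) (trans (!-∘ X Y h) (∘ₛ-zerʳ y))) ,
    eq
    where
    eq : ∀ h → X ! h ≡ Y ! h → Z ! h ≡ X ! h
    eq h x≡y with X ! h ≟ zer
    ... | yes x = trans (rest h (λ k → proj₁ k x)) (trans (!-∘ X Y h) (trans (∘ₛ-zerˡ x) (sym x≡y)))
    ... | no x = trans (rest h (λ k → x (≡-ₛ⇒≡zer (trans (proj₂ k) (cong -ₛ_ (sym x≡y)))))) (trans (!-∘ X Y h) (∘ₛ-nonzeroˡ x))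

  cocircuit-neg : ∀ {X} → Cocircuit O X → Cocircuit O (negV X)
  cocircuit-neg {X} (cX , X≢𝟎 , min) = cov-neg O cX , negV-≢𝟎 X≢𝟎 , λ Y cY Y≢𝟎 Y≼ →
    trans (sym (negV-involutive Y)) (cong negV (min (negV Y) (cov-neg O cY) (negV-≢𝟎 Y≢𝟎)
      λ e → subst (_≼ X ! e) (sym (!-negV Y e)) (flip≼ (subst (Y ! e ≼_) (!-negV X e) (Y≼ e)))))
    where
    flip≼ : s ≼ (-ₛ t) → (-ₛ s) ≼ t
    flip≼ zer≼ = zer≼
    flip≼ {t = t} refl≼ = subst (_≼ t) (sym (-ₛ-involutive t)) refl≼

  -- Eliminating the separating elements of W and V one at a time (L lists
  -- those still to be treated) produces a covector conforming to V.
  private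
    support-minimal′ : ∀ {V} → Cocircuit O V → (L : List (Fin n)) → ∀ {W} → Cov O W → W ≢ 𝟎 →
      (∀ h → V ! h ≡ zer → W ! h ≡ zer) → (∀ h → Sep W V h → h ∈ₗ L) →
      ∀ h → V ! h ≢ zer → W ! h ≢ zer
    support-minimal′ {V} cV@(_ , _ , min) [] {W} cW W≢𝟎 sub sep h Vh Wh =
      Vh (trans (sym (cong (_! h) (min W cW W≢𝟎 λ e → ≼-intro λ We →
        decidable-stable (W ! e ≟ V ! e) λ p →
          case sep e (We , ≢⇒≡-ₛ We (λ Ve → We (sub e Ve)) p) of λ ()))) Wh)
    support-minimal′ {V} cV (e ∷ L) {W} cW W≢𝟎 sub sep h Vh Wh
      with W ! e ≟ zer | W ! e ≟ (-ₛ (V ! e))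
    ... | yes We | _ = support-minimal′ cV L cW W≢𝟎 sub
          (λ k sk → case sep k sk of λ { (here refl) → contradiction We (proj₁ sk) ; (there p) → p }) h Vh Wh
    ... | no _ | no We = support-minimal′ cV L cW W≢𝟎 sub
          (λ k sk → case sep k sk of λ { (here refl) → contradiction (proj₂ sk) We ; (there p) → p }) h Vh Wh
    ... | no We | yes W≡-V with elimination cW (proj₁ cV) e We W≡-V
    ... | Z , cZ , Ze , Z₁ , Z₂ , Z₃ =
          -- `Z` agrees with `V` at `h` and so is nonzero; `e` replaces `h` as the place where `V`
          -- is nonzero and the new covector vanishes.
          support-minimal′ cV L cZ (!-nonzero⇒≢𝟎 h (λ Zh → Vh (trans (sym (Z₁ h Wh)) Zh)))
            (λ k Vk → trans (Z₂ k Vk) (sub k Vk)) sep′ e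
            (λ Ve → We (trans W≡-V (cong -ₛ_ Ve))) Ze
      where
      sep′ : ∀ k → Sep Z V k → k ∈ₗ L
      sep′ k (Zk , Z≡-V) = case sep k (Wk , ≢⇒≡-ₛ Wk Vk W≢V) of
          λ { (here refl) → contradiction Ze Zk ; (there p) → p }
        where
        Z≢V : Z ! k ≢ V ! k
        Z≢V p = Zk (≡-ₛ⇒≡zer (trans Z≡-V (cong -ₛ_ (sym p))))
        Wk : W ! k ≢ zer
        Wk p = Z≢V (Z₁ k p)
        Vk : V ! k ≢ zer
        Vk p = Zk (trans Z≡-V (cong -ₛ_ p))
        W≢V : W ! k ≢ V ! k
        W≢V p = Z≢V (trans (Z₃ k p) p)

  support-minimal : ∀ {V W} → Cocircuit O V → Cov O W → W ≢ 𝟎 →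
    (∀ h → V ! h ≡ zer → W ! h ≡ zer) → ∀ h → V ! h ≢ zer → W ! h ≢ zer
  support-minimal cV cW W≢𝟎 sub = support-minimal′ cV (allFin n) cW W≢𝟎 sub (λ h _ → ∈-allFin h)

  -- If `W` agreed with `V` at one element of the support of `V` and differed at another,
  -- eliminating the latter would leave a nonzero covector of smaller support, against
  -- `support-minimal`.
  support-unique : ∀ {V W} → Cocircuit O V → Cov O W → W ≢ 𝟎 →
    (∀ h → V ! h ≡ zer → W ! h ≡ zer) → W ≡ V ⊎ W ≡ negV V
  support-unique {V} {W} cV cW W≢𝟎 sub with any? (λ e → ¬? (V ! e ≟ zer) ×-dec (W ! e ≟ V ! e))
  ... | yes (e , Ve , W≡V) = inj₁ (!-ext agree)
    where
    agree : ∀ h → W ! h ≡ V ! h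
    agree h with V ! h ≟ zer | W ! h ≟ V ! h
    ... | _ | yes p = p
    ... | yes p | _ = trans (sub h p) (sym p)
    ... | no p | no q with support-minimal cV cW W≢𝟎 sub h p
    ... | Wh with elimination cW (proj₁ cV) h Wh (≢⇒≡-ₛ Wh p q)
    ... | Z , cZ , Zh , Z₁ , Z₂ , Z₃ = contradiction Zh
          (support-minimal cV cZ (!-nonzero⇒≢𝟎 e (λ Ze → Ve (trans (sym W≡V) (trans (sym (Z₃ e W≡V)) Ze))))
            (λ k Vk → trans (Z₂ k Vk) (sub k Vk)) h p)
  ... | no ∄e = inj₂ (!-ext λ h → trans (opposed h) (sym (!-negV V h)))
    where
    opposed : ∀ h → W ! h ≡ -ₛ (V ! h)
    opposed h with V ! h ≟ zer
    ... | yes p = trans (sub h p) (cong -ₛ_ (sym p))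
    ... | no p = ≢⇒≡-ₛ (support-minimal cV cW W≢𝟎 sub h p) p (λ q → ∄e (h , p , q))

  elim-above : ∀ X Y {g Z} → Elim O (negV X) Y g Z → Above X Y Z
  elim-above X Y {Z = Z} (_ , _ , val) h Xh Yh = decidable-stable (Z ! h ≟ zer) λ Zh →
    [ (λ p → Zh (trans p (trans (!-negV X h) (cong -ₛ_ Xh)))) , (λ p → Zh (trans p Yh)) ]′ (val h Zh)

  elim-swap : ∀ X Y {g Z} → Elim O (negV X) Y g Z → Elim O (negV Y) X g (negV Z)
  elim-swap X Y {g} {Z} (cZ , Zg , val) = cocircuit-neg cZ , trans (!-negV Z g) (cong -ₛ_ Zg) , λ h p →
    [ (λ q → inj₂ (trans (!-negV Z h) (trans (cong -ₛ_ (trans q (!-negV X h))) (-ₛ-involutive (X ! h))))) ,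
      (λ q → inj₁ (trans (!-negV Z h) (trans (cong -ₛ_ q) (sym (!-negV Y h))))) ]′
    (val h λ Zh → p (trans (!-negV Z h) (cong -ₛ_ Zh)))

  elim-neg : ∀ X Y {g Z} → Elim O X Y g Z → Elim O (negV X) (negV Y) g (negV Z)
  elim-neg X Y {g} {Z} (cZ , Zg , val) = cocircuit-neg cZ , trans (!-negV Z g) (cong -ₛ_ Zg) , λ h p →
    [ (λ q → inj₁ (trans (!-negV Z h) (trans (cong -ₛ_ q) (sym (!-negV X h))))) ,
      (λ q → inj₂ (trans (!-negV Z h) (trans (cong -ₛ_ q) (sym (!-negV Y h))))) ]′
    (val h λ Zh → p (trans (!-negV Z h) (cong -ₛ_ Zh)))

  comodular-sym : ∀ {X Y} → Comodular O X Y → Comodular O Y X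
  comodular-sym {X} {Y} (cX , cY , p , q , r , k , hr , hk , eq) =
    cY , cX , (λ x → p (sym x)) , (λ x → q (trans (sym (negV-involutive X)) (cong negV (sym x)))) , r , k , hr ,
    subst (λ A → HasRank O A k) (z-cong (X ∘ Y) (Y ∘ X) (comm X Y) (comm Y X)) hk , eq
    where
    comm : ∀ X Y h → (X ∘ Y) ! h ≡ zer → (Y ∘ X) ! h ≡ zer
    comm X Y h p with x , y ← ∘ₛ≡zer {X ! h} (trans (sym (!-∘ X Y h)) p) = trans (!-∘ Y X h) (trans (∘ₛ-zerˡ y) x)

  comodular-neg : ∀ {X Y} → Comodular O X Y → Comodular O (negV X) (negV Y)
  comodular-neg {X} {Y} (cX , cY , p , q , r , k , hr , hk , eq) =
    cocircuit-neg cX , cocircuit-neg cY , (λ x → p (negV-injective x)) , (λ x → q (negV-injective x)) , r , k , hr ,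
    subst (λ A → HasRank O A k) (z-cong (X ∘ Y) (negV X ∘ negV Y) to from) hk , eq
    where
    to : ∀ h → (X ∘ Y) ! h ≡ zer → (negV X ∘ negV Y) ! h ≡ zer
    to h p with x , y ← ∘ₛ≡zer (trans (sym (!-∘ X Y h)) p) =
      trans (!-∘ (negV X) (negV Y) h) (trans (∘ₛ-zerˡ (trans (!-negV X h) (cong -ₛ_ x))) (trans (!-negV Y h) (cong -ₛ_ y)))
    from : ∀ h → (negV X ∘ negV Y) ! h ≡ zer → (X ∘ Y) ! h ≡ zer
    from h p with x , y ← ∘ₛ≡zer (trans (sym (!-∘ (negV X) (negV Y) h)) p) =
      trans (!-∘ X Y h) (trans (∘ₛ-zerˡ (-ₛ≡zer (trans (sym (!-negV X h)) x))) (-ₛ≡zer (trans (sym (!-negV Y h)) y)))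

  -- If the support of `X` were contained in that of `Y`, conformality would give `X ≼ᵥ Y`, and
  -- minimality of `Y` would force equality.
  conformal-difference : ∀ X Y → Conformal X Y → Cocircuit O X → Cocircuit O Y → X ≢ Y →
    ∃[ h ] (X ! h ≢ zer × Y ! h ≡ zer)
  conformal-difference X Y cf (cX , X≢𝟎 , _) (_ , _ , min) X≢Y
    with any? (λ h → ¬? (X ! h ≟ zer) ×-dec (Y ! h ≟ zer))
  ... | yes p = p
  ... | no ∄h = contradiction (min X cX X≢𝟎 λ e → ≼-intro λ Xe → conformal-≡ X Y cf e Xe λ Ye → ∄h (e , Xe , Ye)) X≢Y

  chain-snoc : ∀ {A B C k} → Chain O A B k → Flat O C → B ⊂ C → Chain O A C (suc k)
  chain-snoc (done fB) fC B⊂C = step fB B⊂C (done fC)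
  chain-snoc (step fA A⊂ ch) fC B⊂C = step fA A⊂ (chain-snoc ch fC B⊂C)

  -- The form in which comodularity is used: above `z (X ∘ Y)` a chain of flats has room for at most
  -- two strict steps.
  comodular-corank : ∀ {X Y} → Comodular O X Y →
    ∃[ k ] ((∃[ A ] Chain O A (z (X ∘ Y)) k) × (∀ A m → Chain O A (Full O) m → m ≤ 2 + k))
  comodular-corank (_ , _ , _ , _ , r , k , (_ , bound) , (ch , _) , k+2≡r) =
    k , ch , λ A m c → ≤-trans (bound A m c) (≤-reflexive (trans (sym k+2≡r) (+-comm k 2)))

  -- The line through a conformal comodular pair.

  module Edge {X Y} (cf : Conformal X Y) (cm : Comodular O X Y) where

    private
      cX = proj₁ cm
      cY = proj₁ (proj₂ cm)
      X≢Y = proj₁ (proj₂ (proj₂ cm))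

    X-only : ∃[ h ] (X ! h ≢ zer × Y ! h ≡ zer)
    X-only = conformal-difference X Y cf cX cY X≢Y

    Y-only : ∃[ h ] (Y ! h ≢ zer × X ! h ≡ zer)
    Y-only = conformal-difference Y X (conformal-sym X Y cf) cY cX (λ p → X≢Y (sym p))

    -- The contraction at z(X ∘ Y) has rank 2.
    cocircuit-above : ∀ {W} → Cov O W → W ≢ 𝟎 → Above X Y W →
      ∀ h → ¬ (X ! h ≡ zer × Y ! h ≡ zer) → W ! h ≡ zer → Cocircuit O W
    cocircuit-above {W} cW W≢𝟎 ab h h∉F Wh = cW , W≢𝟎 , λ V cV V≢𝟎 V≼W →
      decidable-stable (V ≟ᵥ W) λ V≢W → tooLong V cV V≢𝟎 V≼W V≢W
      where
      tooLong : ∀ V → Cov O V → V ≢ 𝟎 → V ≼ᵥ W → V ≢ W → ⊥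
      tooLong V cV V≢𝟎 V≼W V≢W
        with any? (λ e → ¬? (W ! e ≟ zer) ×-dec (V ! e ≟ zer)) | comodular-corank cm
      ... | no ∄e | _ = V≢W (!-ext eq)
        where
        below : s ≼ t → (t ≢ zer → s ≢ zer) → s ≡ t
        below refl≼ _ = refl
        below {t = t} zer≼ p with t ≟ zer
        ... | yes q = sym q
        ... | no q = contradiction refl (p q)
        eq : ∀ e → V ! e ≡ W ! e
        eq e = below (V≼W e) (λ We Ve → ∄e (e , We , Ve))
      ... | yes (e , We , Ve) | (k , (A , ch) , bound)
        with ≢𝟎⇒!-nonzero V≢𝟎
      ... | e′ , Ve′ = 1+n≰n (bound A _ long)
        where
        X∘Y≡zer : ∀ k → (X ∘ Y) ! k ≡ zer → X ! k ≡ zer × Y ! k ≡ zer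
        X∘Y≡zer k p = ∘ₛ≡zer (trans (sym (!-∘ X Y k)) p)
        below-zer : ∀ k → W ! k ≡ zer → V ! k ≡ zer
        below-zer k p with V ! k | W ! k | V≼W k
        ... | _ | _ | zer≼ = refl
        ... | _ | _ | refl≼ = p
        long : Chain O A (Full O) (suc (suc (suc k)))
        -- With `V` strictly below `W`, the flats `z (X ∘ Y)`, `z W`, `z V` and the full set
        -- increase strictly: three steps where only two fit.
        long = chain-snoc (chain-snoc (chain-snoc ch
          (W , cW , refl) (z-⊂ (X ∘ Y) W (λ k p → ab k (proj₁ (X∘Y≡zer k p)) (proj₂ (X∘Y≡zer k p))) h (λ p → h∉F (X∘Y≡zer h p)) Wh))
          (V , cV , refl) (z-⊂ W V below-zer e We Ve))
          (𝟎 , cov-zero O , refl) (z-⊂ V 𝟎 (λ k _ → !-𝟎 k) e′ Ve′ (!-𝟎 e′))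

    -- On a line, a zero outside the flat determines a cocircuit up to sign. `A ∘ B` vanishes at `h`
    -- too, so it is a cocircuit and equals `A` by minimality; hence the support of `B` lies in that
    -- of `A`.
    unique-above : ∀ {A B} → Cov O A → Cov O B → A ≢ 𝟎 → B ≢ 𝟎 → Above X Y A → Above X Y B →
      ∀ h → ¬ (X ! h ≡ zer × Y ! h ≡ zer) → A ! h ≡ zer → B ! h ≡ zer → B ≡ A ⊎ B ≡ negV A
    unique-above {A} {B} cA cB A≢𝟎 B≢𝟎 abA abB h h∉F Ah Bh =
      support-unique (cocircuit-above cA A≢𝟎 abA h h∉F Ah) cB B≢𝟎 λ k Ak →
        trans (sym (∘ₛ-zerˡ Ak)) (trans (sym (!-∘ A B k)) (trans (cong (_! k) (sym A≡A∘B)) Ak))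
      where
      ab-at : ∀ k → A ! k ≡ zer → B ! k ≡ zer → (A ∘ B) ! k ≡ zer
      ab-at k p q = trans (!-∘ A B k) (trans (∘ₛ-zerˡ p) q)
      A∘B≢𝟎 : A ∘ B ≢ 𝟎
      A∘B≢𝟎 p with e , Ae ← ≢𝟎⇒!-nonzero A≢𝟎 =
        Ae (proj₁ (∘ₛ≡zer (trans (sym (!-∘ A B e)) (trans (cong (_! e) p) (!-𝟎 e)))))
      A≡A∘B : A ≡ A ∘ B
      A≡A∘B = proj₂ (proj₂ (cocircuit-above (cov-comp O cA cB) A∘B≢𝟎
          (λ k p q → ab-at k (abA k p q) (abB k p q)) h h∉F (ab-at h Ah Bh)))
        A cA A≢𝟎 λ e → ≼-intro λ Ae → sym (trans (!-∘ A B e) (∘ₛ-nonzeroˡ Ae))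

    module _ {g} (Xg : X ! g ≢ zer) (X≡Y : X ! g ≡ Y ! g) where

      -- The axiom supplies only a covector. It is a cocircuit because it vanishes at `g`, outside
      -- `z (X ∘ Y)`, and is nonzero where only `X` is.
      elim-exists : ∃[ Z ] Elim O (negV X) Y g Z
      elim-exists with elimination (cov-neg O (proj₁ cX)) (proj₁ cY) g
                         (λ p → Xg (-ₛ≡zer (trans (sym (!-negV X g)) p)))
                         (trans (!-negV X g) (cong -ₛ_ X≡Y))
      ... | Z , cZ , Zg , Z₁ , Z₂ , Z₃ =
        Z , cocircuit-above cZ Z≢𝟎 above g (λ p → Xg (proj₁ p)) Zg , Zg , val
        where
        above : Above X Y Z
        above h Xh Yh = trans (Z₂ h Yh) (trans (!-negV X h) (cong -ₛ_ Xh))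
        Z≢𝟎 : Z ≢ 𝟎
        Z≢𝟎 = let h , Xh , Yh = X-only in !-nonzero⇒≢𝟎 h λ Zh →
          Xh (-ₛ≡zer (trans (sym (!-negV X h)) (trans (sym (Z₂ h Yh)) Zh)))
        val : ∀ h → Z ! h ≢ zer → Z ! h ≡ negV X ! h ⊎ Z ! h ≡ Y ! h
        val h Zh with Z ! h ≟ (Y ! h) | Y ! h ≟ zer
        ... | yes p | _ = inj₂ p
        ... | no _ | yes q = inj₁ (Z₂ h q)
        ... | no p | no q with X ! h ≟ zer
        ... | yes r = inj₂ (Z₁ h (trans (!-negV X h) (cong -ₛ_ r)))
        ... | no r = inj₁ (trans (≢⇒≡-ₛ Zh q p) (trans (cong -ₛ_ (sym (conformal-≡ X Y cf h r q))) (sym (!-negV X h))))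

      -- `Elim` prescribes signs only where `Z` is nonzero. If `Z` vanished at `h`, where `Y` does
      -- too, it would be `Y` up to sign; but `Z` vanishes at `g` and `Y` does not.
      elim-at-X-only : ∀ {Z} → Elim O (negV X) Y g Z → ∀ h → X ! h ≢ zer → Y ! h ≡ zer → Z ! h ≡ -ₛ (X ! h)
      elim-at-X-only {Z} el@(cZ , Zg , val) h Xh Yh with Z ! h ≟ zer
      ... | no Zh = [ (λ p → trans p (!-negV X h)) , (λ p → contradiction (trans p Yh) Zh) ]′ (val h Zh)
      ... | yes Zh with unique-above (proj₁ cZ) (proj₁ cY) (proj₁ (proj₂ cZ)) (proj₁ (proj₂ cY))
                          (elim-above X Y el) (λ _ _ p → p) h (λ p → Xh (proj₁ p)) Zh Yh
      ... | inj₁ refl = contradiction (trans X≡Y Zg) Xg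
      ... | inj₂ refl = contradiction (trans X≡Y (trans (!-negV Z g) (cong -ₛ_ Zg))) Xg

  module _ {X Y} (cf : Conformal X Y) (cm : Comodular O X Y) {g} (Xg : X ! g ≢ zer) (X≡Y : X ! g ≡ Y ! g) where

    elim-at-Y-only : ∀ {Z} → Elim O (negV X) Y g Z → ∀ h → Y ! h ≢ zer → X ! h ≡ zer → Z ! h ≡ Y ! h
    elim-at-Y-only {Z} el h Yh Xh =
      trans (sym (-ₛ-involutive (Z ! h))) (trans (cong -ₛ_ (trans (sym (!-negV Z h))
        (Edge.elim-at-X-only (conformal-sym X Y cf) (comodular-sym cm) (λ p → Xg (trans X≡Y p)) (sym X≡Y) (elim-swap X Y el) h Yh Xh)))
        (-ₛ-involutive (Y ! h)))

-- Single-element extensions in which p is not a coloop.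

module Extension (O : OrientedMatroid n) (Õ : OrientedMatroid (suc n)) (σ : SV n → Sign)
  (ext : IsExtension Õ O σ) (no-coloop : ¬ Cov Õ (pos ∷ 𝟎)) where

  lift : ∀ {X} → Cov O X → ∃[ s ] Cov Õ (s ∷ X)
  lift {X} = proj₁ (proj₁ ext X)

  delete : ∀ {s X} → Cov Õ (s ∷ X) → Cov O X
  delete {s} {X} c = proj₂ (proj₁ ext X) (s , c)

  nonzero-p : s ≢ zer → ¬ Cov Õ (s ∷ 𝟎)
  nonzero-p {pos} _ c = no-coloop c
  nonzero-p {neg} _ c = no-coloop (subst (λ V → Cov Õ (pos ∷ V)) negV-𝟎 (cov-neg Õ c))
  nonzero-p {zer} p _ = p refl

  -- Eliminating an element of `V` between one lift and the negative of the other leaves, by support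
  -- minimality, a covector supported at most on p. Different signs would make it nonzero there, so
  -- p would be a coloop.
  lift-unique : ∀ {V} → Cocircuit O V → Cov Õ (s ∷ V) → Cov Õ (t ∷ V) → s ≡ t
  lift-unique {s} {t} {V} cV cs ct with s ≟ t
  ... | yes p = p
  ... | no s≢t with ≢𝟎⇒!-nonzero (proj₁ (proj₂ cV))
  ... | h , Vh with elimination Õ cs (cov-neg Õ ct) (suc h) Vh
                      (trans (sym (-ₛ-involutive (V ! h))) (cong -ₛ_ (sym (!-negV V h))))
  ... | (c ∷ W) , cW , Wh , W₁ , W₂ , W₃ = ⊥-elim (nonzero-p c≢zer (subst (λ U → Cov Õ (c ∷ U)) W≡𝟎 cW))
    where
    c≢zer : c ≢ zer
    c≢zer c≡zer with s ≟ zer | t ≟ zer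
    ... | yes p | _ = s≢t (trans p (sym (-ₛ≡zer (trans (sym (W₁ zero p)) c≡zer))))
    ... | no p | yes q = p (trans (sym (W₂ zero (cong -ₛ_ q))) c≡zer)
    ... | no p | no q = p (trans (sym (W₃ zero (≢⇒≡-ₛ p q s≢t))) c≡zer)
    W≡𝟎 : W ≡ 𝟎
    W≡𝟎 = decidable-stable (W ≟ᵥ 𝟎) λ W≢𝟎 →
      support-minimal O cV (delete cW) W≢𝟎 (λ k Vk → trans (W₁ (suc k) Vk) (trans (!-negV V k) (cong -ₛ_ Vk))) h Vh Wh

  lift-σ : ∀ {V} → Cocircuit O V → Cov Õ (s ∷ V) → s ≡ σ V
  lift-σ {V = V} cV c = lift-unique cV c (proj₂ ext V cV)

  -- A covector `Y` below `X` lifts to one below `pos ∷ X` unless its sign at p is `neg`. In that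
  -- case eliminating p against `pos ∷ X` yields `zer ∷ X`, against minimality.
  vertex-cocircuit : ∀ {X} → Cocircuit Õ (pos ∷ X) → Cocircuit O X
  vertex-cocircuit {X} (cX , _ , min) = delete cX , X≢𝟎 , λ Y cY Y≢𝟎 Y≼X → below Y Y≢𝟎 Y≼X (lift cY)
    where
    X≢𝟎 : X ≢ 𝟎
    X≢𝟎 refl = no-coloop cX
    below : ∀ Y → Y ≢ 𝟎 → Y ≼ᵥ X → ∃[ s ] Cov Õ (s ∷ Y) → Y ≡ X
    below Y Y≢𝟎 Y≼X (pos , c) = ∷-injectiveʳ (min (pos ∷ Y) c (λ p → Y≢𝟎 (∷-injectiveʳ p)) λ { zero → refl≼ ; (suc e) → Y≼X e })
    below Y Y≢𝟎 Y≼X (zer , c) = ∷-injectiveʳ (min (zer ∷ Y) c (λ p → Y≢𝟎 (∷-injectiveʳ p)) λ { zero → zer≼ ; (suc e) → Y≼X e })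
    below Y Y≢𝟎 Y≼X (neg , c) with elimination Õ c cX zero (λ ()) refl
    ... | (zer ∷ W) , cW , refl , W₁ , _ , W₃ =
      case min (zer ∷ X) (subst (λ U → Cov Õ (zer ∷ U)) W≡X cW) (λ p → X≢𝟎 (∷-injectiveʳ p))
             (λ { zero → zer≼ ; (suc e) → refl≼ }) of λ ()
      where
      agree : ∀ h → Y ! h ≼ X ! h → W ! h ≡ X ! h
      agree h Yh≼Xh with Y ! h ≟ X ! h | Y ! h ≟ zer
      ... | yes p | _ = trans (W₃ (suc h) p) p
      ... | no _ | yes q = W₁ (suc h) q
      ... | no p | no q with Y ! h | X ! h | Yh≼Xh
      ... | _ | _ | zer≼ = contradiction refl q
      ... | _ | _ | refl≼ = contradiction refl p
      W≡X : W ≡ X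
      W≡X = !-ext λ h → agree h (Y≼X h)

  -- Flats below a flat avoiding p correspond to flats of O ...
  chain-delete : ∀ {A F k} → Chain Õ A (false ∷ F) k → ∃[ A′ ] (A ≡ false ∷ A′ × Chain O A′ F k)
  chain-delete {F = F} (done ((s ∷ X) , c , p)) = F , refl , done (X , delete c , ∷-injectiveʳ p)
  chain-delete {A = a ∷ A} (step ((s ∷ X) , c , p) A⊂B ch) with chain-delete ch
  ... | B , refl , ch′ with a
  ... | true = case proj₁ A⊂B here of λ ()
  ... | false = A , refl , step (X , delete c , ∷-injectiveʳ p) (drop-∷-⊂ A⊂B) ch′

  chain-head : ∀ {A B k} → Chain Õ A B k → Flat Õ A
  chain-head (done f) = f
  chain-head (step f _ _) = f

  -- ... while every chain of O lifts, composing each covector with the one above it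
  -- so that p only enters going up.
  chain-lift : ∀ {A B b k} → Chain O A B k → Flat Õ (b ∷ B) → ∃[ a ] Chain Õ (a ∷ A) (b ∷ B) k
  chain-lift {b = b} (done _) f = b , done f
  chain-lift {A} (step {B = B} (W , cW , refl) (A⊆B , x , x∈B , x∉A) ch) f
    with chain-lift ch f
  ... | b′ , ch′ with chain-head ch′ | lift cW
  ... | ((t ∷ V) , cV , refl) | s , csW =
    _ , step ((s ∷ W) ∘ (t ∷ V) , cov-comp Õ csW cV , cong (isZero (s ∘ₛ t) ∷_) (z-cong (W ∘ V) W
          (λ h p → proj₁ (∘ₛ≡zer (trans (sym (!-∘ W V h)) p)))
          (λ h p → trans (!-∘ W V h) (trans (∘ₛ-zerˡ p) (∈z⁻ V (A⊆B (∈z⁺ W p)))))))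
        (sub , suc x , there x∈B , λ p → x∉A (drop-there p)) ch′
    where
    sub : isZero (s ∘ₛ t) ∷ z W ⊆ isZero t ∷ z V
    sub {zero} p = ∈z⁺ (t ∷ V) (proj₂ (∘ₛ≡zer {s} (∈z⁻ ((s ∘ₛ t) ∷ W) p)))
    sub {suc e} p = there (A⊆B (drop-there p))

  -- Both ranks stay the same. The upper bounds come from lifting chains. The flat of the pair
  -- avoids p, so its longest chain can be deleted; the full set contains p, so a chain to it is
  -- built afresh through `z X`.
  comodular-delete : ∀ {X Y} → Conformal (pos ∷ X) (pos ∷ Y) → Comodular Õ (pos ∷ X) (pos ∷ Y) → Comodular O X Y
  comodular-delete {X} {Y} cf (cX̃ , cỸ , X≢Y , _ , r , k , (_ , r-bound) , ((A , ch) , k-bound) , k+2≡r)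
    with chain-delete ch
  ... | A′ , _ , ch′ = cX , cY , X≢Y′ , X≢-Y , r , k ,
    ((A′ , subst (Chain O A′ (Full O)) (trans (+-comm 2 k) k+2≡r) ch+2) ,
      λ B m c → r-bound _ m (proj₂ (chain-lift c (𝟎 , cov-zero Õ , refl)))) ,
    ((A′ , ch′) ,
      λ B m c → k-bound _ m (proj₂ (chain-lift c ((pos ∷ X) ∘ (pos ∷ Y) , cov-comp Õ (proj₁ cX̃) (proj₁ cỸ) , refl)))) ,
    k+2≡r
    where
    cX = vertex-cocircuit cX̃
    cY = vertex-cocircuit cỸ
    cf′ : Conformal X Y
    cf′ e = cf (suc e)
    X≢Y′ : X ≢ Y
    X≢Y′ p = X≢Y (cong (pos ∷_) p)
    X≢-Y : X ≢ negV Y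
    X≢-Y p with h , Xh ← ≢𝟎⇒!-nonzero (proj₁ (proj₂ cX)) = cf′ h (Xh , trans (cong (_! h) p) (!-negV Y h))
    ch+2 : Chain O A′ (Full O) (2 + k)
    ch+2 with h , Yh , Xh ← conformal-difference O Y X (conformal-sym X Y cf′) cY cX (λ p → X≢Y′ (sym p))
            | e , Xe ← ≢𝟎⇒!-nonzero (proj₁ (proj₂ cX)) =
      chain-snoc O (chain-snoc O ch′ (X , proj₁ cX , refl)
          (z-⊂ (X ∘ Y) X (λ l p → proj₁ (∘ₛ≡zer (trans (sym (!-∘ X Y l)) p))) h
            (λ p → Yh (proj₂ (∘ₛ≡zer {X ! h} (trans (sym (!-∘ X Y h)) p)))) Xh))
        (𝟎 , cov-zero O , refl) (z-⊂ X 𝟎 (λ l _ → !-𝟎 l) e Xe (!-𝟎 e))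

  -- `dominant` says that on this line the localization is decided by `e` wherever `e` is nonzero,
  -- so that p behaves as an infinitesimal perturbation of `e` with sign `a`.
  module ExtEdge {X Y} (cf̃ : Conformal (pos ∷ X) (pos ∷ Y)) (cm̃ : Comodular Õ (pos ∷ X) (pos ∷ Y))
    {e a} (a≢zer : a ≢ zer) (dominant : ∀ W → Above X Y W → W ! e ≢ zer → σ W ≡ a *ₛ (W ! e))
    {Z} (el : Elim Õ (negV (pos ∷ X)) (pos ∷ Y) zero (zer ∷ Z)) where

    private
      cf : Conformal X Y
      cf h = cf̃ (suc h)
      cm = comodular-delete cf̃ cm̃
      cX = proj₁ cm
      cY = proj₁ (proj₂ cm)
      cX̃ = proj₁ cm̃
      cỸ = proj₁ (proj₂ cm̃)
      Z̃-cov : Cov Õ (zer ∷ Z)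
      Z̃-cov = proj₁ (proj₁ el)
      Z-cov : Cov O Z
      Z-cov = delete Z̃-cov
      module E = Edge O cf cm
      module Ẽ = Edge Õ cf̃ cm̃

      Z-above : Above X Y Z
      Z-above h = elim-above Õ (pos ∷ X) (pos ∷ Y) {zero} {zer ∷ Z} el (suc h)

      Z≢𝟎 : Z ≢ 𝟎
      Z≢𝟎 refl = proj₁ (proj₂ (proj₁ el)) refl

      zer-lift : ∀ {W} → Cov Õ (zer ∷ W) → Cocircuit O W → σ W ≡ zer
      zer-lift c cW = sym (lift-σ cW c)

      -- The line contains p in general position unless e vanishes on Z.
      Z-full : Z ! e ≢ zer → ∀ h → ¬ (X ! h ≡ zer × Y ! h ≡ zer) → Z ! h ≢ zer
      Z-full Ze h h∉F Zh = *ₛ-nonzero a≢zer Ze (trans (sym (dominant Z Z-above Ze))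
        (zer-lift Z̃-cov (E.cocircuit-above Z-cov Z≢𝟎 Z-above h h∉F Zh)))

      -- If `Z` vanished at `e` as `W` does, the two would agree up to sign, and `zer ∷ Z` would
      -- force `σ W` to be zero.
      Z-nonzero-e : ∀ {W} → Cocircuit O W → Above X Y W → ¬ (X ! e ≡ zer × Y ! e ≡ zer) →
        W ! e ≡ zer → σ W ≢ zer → Z ! e ≢ zer
      Z-nonzero-e {W} cW abW e∉F We σW Ze
        with E.unique-above (proj₁ cW) Z-cov (proj₁ (proj₂ cW)) Z≢𝟎 abW Z-above e e∉F We Ze
      ... | inj₁ refl = σW (zer-lift Z̃-cov cW)
      ... | inj₂ refl = σW (zer-lift (subst (λ U → Cov Õ (zer ∷ U)) (negV-involutive W) (cov-neg Õ Z̃-cov)) cW)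

      -- Eliminating h between Z and W reads off σ on the resulting cocircuit twice.
      no-crossing : ∀ {W} → Cocircuit O W → Above X Y W → W ! e ≡ zer → Z ! e ≢ zer →
        a *ₛ (Z ! e) ≢ σ W → ∀ h → W ! h ≢ zer → Z ! h ≢ zer → Z ! h ≡ W ! h
      no-crossing {W} cW abW We Ze σ≢ h Wh Zh = decidable-stable (Z ! h ≟ W ! h) λ Z≢W → absurd Z≢W
        where
        absurd : Z ! h ≢ W ! h → ⊥
        absurd Z≢W with elimination Õ Z̃-cov (proj₂ ext W cW) (suc h) Zh (≢⇒≡-ₛ Zh Wh Z≢W)
        ... | (t ∷ V) , cV , Vh , V₁ , V₂ , _ =
          -- `V` keeps the entry of `Z` at `e`, so `dominant` reads `a *ₛ (Z ! e)`; its sign at p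
          -- comes from `W` alone and reads `σ W`.
          σ≢ (trans (cong (a *ₛ_) (sym Ve)) (trans (sym (dominant V abV (λ p → Ze (trans (sym Ve) p))))
            (trans (sym (lift-σ cocV cV)) (V₁ zero refl))))
          where
          Ve : V ! e ≡ Z ! e
          Ve = V₂ (suc e) We
          abV : Above X Y V
          abV k Xk Yk = trans (V₁ (suc k) (Z-above k Xk Yk)) (abW k Xk Yk)
          cocV : Cocircuit O V
          cocV = E.cocircuit-above (delete cV) (!-nonzero⇒≢𝟎 e (λ p → Ze (trans (sym Ve) p))) abV h
            (λ (Xh , Yh) → Wh (abW h Xh Yh)) Vh

    -- Apply `no-crossing` to `Y`: `σ Y` is `pos` because `Y` is a vertex, while `Z ! e` is the
    -- negative of `a`, inherited from `negV X`.
    leaving : X ! e ≡ a → Y ! e ≡ zer → ∀ f → Y ! f ≢ zer → Z ! f ≡ Y ! f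
    leaving Xe Ye f Yf = no-crossing cY (λ _ _ p → p) Ye Ze σ≢ f Yf (Z-full Ze f (λ p → Yf (proj₂ p)))
      where
      σY : σ Y ≡ pos
      σY = sym (lift-σ cY (proj₁ cỸ))
      Ze : Z ! e ≢ zer
      Ze = Z-nonzero-e cY (λ _ _ p → p) (λ p → a≢zer (trans (sym Xe) (proj₁ p))) Ye (λ p → case trans (sym p) σY of λ ())
      Ze≡-a : Z ! e ≡ -ₛ a
      Ze≡-a = [ (λ p → trans p (trans (!-negV X e) (cong -ₛ_ Xe))) , (λ p → contradiction (trans p Ye) Ze) ]′
        (proj₂ (proj₂ el) (suc e) Ze)
      σ≢ : a *ₛ (Z ! e) ≢ σ Y
      σ≢ p = a≢zer (≡-ₛ⇒≡zer (trans (sym (*ₛ≡pos⇒≡ (trans p σY))) Ze≡-a))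

    module _ (Xe : X ! e ≡ a) (Ye : Y ! e ≡ a) {Z′} (el′ : Elim O (negV X) Y e Z′) where

      private
        cZ′ = proj₁ el′
        Z′e = proj₁ (proj₂ el′)
        Z′-above = elim-above O X Y {e} {Z′} el′
        Xe≢zer : X ! e ≢ zer
        Xe≢zer p = a≢zer (trans (sym Xe) p)
        X≡Y : X ! e ≡ Y ! e
        X≡Y = trans Xe (sym Ye)

        Z-at-X-only : ∀ h → X ! h ≢ zer → Y ! h ≡ zer → Z ! h ≡ -ₛ (X ! h)
        Z-at-X-only h = Ẽ.elim-at-X-only {zero} (λ ()) refl {zer ∷ Z} el (suc h)
        Z-at-Y-only : ∀ h → Y ! h ≢ zer → X ! h ≡ zer → Z ! h ≡ Y ! h
        Z-at-Y-only h = elim-at-Y-only Õ cf̃ cm̃ {zero} (λ ()) refl {zer ∷ Z} el (suc h)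
        Z′-at-X-only : ∀ h → X ! h ≢ zer → Y ! h ≡ zer → Z′ ! h ≡ -ₛ (X ! h)
        Z′-at-X-only = E.elim-at-X-only {e} Xe≢zer X≡Y {Z′} el′
        Z′-at-Y-only : ∀ h → Y ! h ≢ zer → X ! h ≡ zer → Z′ ! h ≡ Y ! h
        Z′-at-Y-only = elim-at-Y-only O cf cm {e} Xe≢zer X≡Y {Z′} el′

        -- Eliminating `k` between `zer ∷ Z` and the lift of `U` gives a cocircuit that vanishes at
        -- `k` like `Z′`. Its entry at `h` makes it `Z′` rather than the negative, yet its sign at p
        -- is opposite to `σ Z′`.
        same-side : ∀ {U} → Cov Õ ((-ₛ σ Z′) ∷ U) → Above X Y U → σ Z′ ≢ zer →
          ∀ h → U ! h ≢ zer → Z ! h ≡ U ! h → Z′ ! h ≡ U ! h →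
          ∀ k → Z′ ! k ≡ zer → ¬ (X ! k ≡ zer × Y ! k ≡ zer) → Z ! k ≢ zer → Z ! k ≢ -ₛ (U ! k)
        same-side {U} cU abU σ≢zer h Uh Z≡U Z′≡U k Z′k k∉F Zk Z≡-U
          with elimination Õ Z̃-cov cU (suc k) Zk Z≡-U
        ... | (t ∷ V) , cV , Vk , V₁ , _ , V₃ = absurd
              (E.unique-above (proj₁ cZ′) (delete cV) (proj₁ (proj₂ cZ′)) V≢𝟎 Z′-above abV k k∉F Z′k Vk)
          where
          Vh : V ! h ≡ U ! h
          Vh = trans (V₃ (suc h) Z≡U) Z≡U
          V≢𝟎 : V ≢ 𝟎
          V≢𝟎 = !-nonzero⇒≢𝟎 h (λ p → Uh (trans (sym Vh) p))
          abV : Above X Y V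
          abV l Xl Yl = trans (V₁ (suc l) (Z-above l Xl Yl)) (abU l Xl Yl)
          absurd : V ≡ Z′ ⊎ V ≡ negV Z′ → ⊥
          absurd (inj₁ refl) = σ≢zer (≡-ₛ⇒≡zer (trans (sym (lift-σ cZ′ cV)) (V₁ zero refl)))
          absurd (inj₂ refl) = Uh (≡-ₛ⇒≡zer (trans (sym Vh) (trans (!-negV Z′ h) (cong -ₛ_ Z′≡U))))

        -- p lies just beside e, on the side given by σ Z′.
        beside : ∀ k → Z′ ! k ≡ zer → X ! k ≢ zer → X ! k ≡ Y ! k → Z ! k ≢ zer → σ Z′ ≢ zer →
          Z ! k ≡ -ₛ (σ Z′ *ₛ (X ! k))
        beside k Z′k Xk Xk≡Yk Zk σ≢zer = ≢⇒≡-ₛ Zk (*ₛ-nonzero σ≢zer Xk) (not-same (σ Z′) refl)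
          where
          k∉F : ¬ (X ! k ≡ zer × Y ! k ≡ zer)
          k∉F p = Xk (proj₁ p)
          not-same : ∀ s → σ Z′ ≡ s → Z ! k ≢ s *ₛ (X ! k)
          not-same zer σ≡ _ = σ≢zer σ≡
          -- `U` must have sign `-ₛ σ Z′` at p: `negV X` serves when `σ Z′` is `pos`, and `Y` when
          -- it is `neg`.
          not-same pos σ≡ Z≡X = let h , Xh , Yh = E.X-only in
            same-side {negV X} (subst (λ s → Cov Õ ((-ₛ s) ∷ negV X)) (sym σ≡) (cov-neg Õ (proj₁ cX̃)))
              (λ l Xl _ → trans (!-negV X l) (cong -ₛ_ Xl)) σ≢zer
              h (λ p → Xh (-ₛ≡zer (trans (sym (!-negV X h)) p)))
              (trans (Z-at-X-only h Xh Yh) (sym (!-negV X h))) (trans (Z′-at-X-only h Xh Yh) (sym (!-negV X h)))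
              k Z′k k∉F Zk (trans Z≡X (trans (sym (-ₛ-involutive (X ! k))) (cong -ₛ_ (sym (!-negV X k)))))
          not-same neg σ≡ Z≡-X = let h , Yh , Xh = E.Y-only in
            same-side {Y} (subst (λ s → Cov Õ ((-ₛ s) ∷ Y)) (sym σ≡) (proj₁ cỸ)) (λ _ _ p → p) σ≢zer
              h Yh (Z-at-Y-only h Yh Xh) (Z′-at-Y-only h Yh Xh)
              k Z′k k∉F Zk (trans Z≡-X (cong -ₛ_ Xk≡Yk))

      -- If `σ Z′` is zero, `zer ∷ Z′` vanishes at p on the same line, so `Z` is `Z′`. Otherwise
      -- `Z ! e` is nonzero: `no-crossing` settles the case `Z′ ! f ≢ zer`, and `beside` the other.
      affine : ∀ f → X ! f ≢ zer → X ! f ≡ Y ! f → Z ! f ≡ Z′ ! f ∘ₛ (-ₛ (σ Z′ *ₛ (X ! f)))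
      affine f Xf Xf≡Yf with σ Z′ ≟ zer
      ... | yes σ≡ = trans Z≡Z′ (sym (∘ₛ-zerʳ (cong (λ s → -ₛ (s *ₛ (X ! f))) σ≡)))
        where
        Z≡Z′ : Z ! f ≡ Z′ ! f
        Z≡Z′ with h , Xh , Yh ← E.X-only
               | Ẽ.unique-above (subst (λ s → Cov Õ (s ∷ Z′)) σ≡ (proj₂ ext Z′ cZ′)) Z̃-cov
                   (λ p → proj₁ (proj₂ cZ′) (∷-injectiveʳ p)) (λ p → Z≢𝟎 (∷-injectiveʳ p))
                   (λ { (suc l) → Z′-above l }) (λ { (suc l) → Z-above l }) zero (λ ()) refl refl
        ... | inj₁ refl = refl
        ... | inj₂ refl = contradiction
              (-ₛ≡zer {X ! h} (trans (sym (Z′-at-X-only h Xh Yh)) (≡-ₛ⇒≡zer (trans (Z′-at-X-only h Xh Yh)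
                (trans (sym (Z-at-X-only h Xh Yh)) (!-negV Z′ h)))))) Xh
      ... | no σ≢ with Z-nonzero-e cZ′ Z′-above (λ p → Xe≢zer (proj₁ p)) Z′e σ≢
      ... | Ze with Z′ ! f ≟ zer
      ... | no Z′f = trans (no-crossing cZ′ Z′-above Z′e Ze σe f Z′f (Z-full Ze f (λ p → Xf (proj₁ p)))) (sym (∘ₛ-nonzeroˡ Z′f))
        where
        -- By `beside` at `e`, the product `a *ₛ (Z ! e)` is the negative of `σ Z′`, which is the
        -- inequality that `no-crossing` asks for.
        flipped : ∀ a s → a ≢ zer → s ≢ zer → a *ₛ (-ₛ (s *ₛ a)) ≢ s
        flipped pos pos _ _ ()
        flipped pos neg _ _ ()
        flipped neg pos _ _ ()
        flipped neg neg _ _ ()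
        flipped zer _ p _ _ = p refl
        flipped _ zer _ p _ = p refl
        σe : a *ₛ (Z ! e) ≢ σ Z′
        σe p = flipped a (σ Z′) a≢zer σ≢ (trans (cong (a *ₛ_) (sym (trans (beside e Z′e Xe≢zer X≡Y Ze σ≢) (cong (λ x → -ₛ (σ Z′ *ₛ x)) Xe)))) p)
      ... | yes Z′f = trans (beside f Z′f Xf Xf≡Yf (Z-full Ze f (λ p → Xf (proj₁ p))) σ≢) (sym (∘ₛ-zerˡ Z′f))

-- Cyclic indices.

private variable
  m : ℕ

-- The cyclic successor lets the closing edge of a cycle be treated like all others.
next : Fin (suc m) → Fin (suc m)
next i with view i
... | ‵fromℕ = zero
... | ‵inject₁ j = suc j

next-inject₁ : (i : Fin m) → next (inject₁ i) ≡ suc i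
next-inject₁ i rewrite view-inject₁ i = refl

next-fromℕ : ∀ m → next (fromℕ m) ≡ zero
next-fromℕ m rewrite view-fromℕ m = refl

next-elim : (R : Fin (suc m) → Fin (suc m) → Set) → (∀ i → R (inject₁ i) (suc i)) → R (fromℕ m) zero →
  ∀ i → R i (next i)
next-elim R p q i with view i
... | ‵fromℕ = q
... | ‵inject₁ j = p j

-- From `i` the property climbs to the last index, wraps to `zero`, and then reaches every index.
cyclic-induction : (Q : Fin (suc m) → Set) → (∀ i → Q i → Q (next i)) → ∀ i → Q i → ∀ j → Q j
cyclic-induction {m} Q closed i Qi = <-weakInduction Q Q-zero
  λ j Qj → subst Q (next-inject₁ j) (closed (inject₁ j) Qj)
  where
  Q-last : Q (fromℕ m)
  Q-last = >-weakInduction (λ j → Q j → Q (fromℕ m)) (λ q → q)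
    (λ j f q → f (subst Q (next-inject₁ j) (closed (inject₁ j) q))) i Qi
  Q-zero : Q zero
  Q-zero = subst Q (next-fromℕ m) (closed (fromℕ m) Q-last)

-- Forward induction for the predicate `Q k → Q j`, starting from the identity at `j`.
cyclic-induction⁻ : (Q : Fin (suc m) → Set) → (∀ i → Q (next i) → Q i) → ∀ i → Q i → ∀ j → Q j
cyclic-induction⁻ Q closed i Qi j =
  cyclic-induction (λ k → Q k → Q j) (λ k f q → f (closed k q)) j (λ q → q) i Qi

opposite-inject₁ : (i : Fin m) → opposite (inject₁ i) ≡ suc (opposite i)
opposite-inject₁ zero = refl
opposite-inject₁ (suc i) = cong inject₁ (opposite-inject₁ i)

opposite-fromℕ : ∀ m → opposite (fromℕ m) ≡ zero
opposite-fromℕ zero = refl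
opposite-fromℕ (suc m) = cong inject₁ (opposite-fromℕ m)

next-opposite-next : (i : Fin (suc m)) → next (opposite (next i)) ≡ opposite i
next-opposite-next {m} = next-elim (λ i j → next (opposite j) ≡ opposite i)
  (λ i → trans (next-inject₁ (opposite i)) (sym (opposite-inject₁ i)))
  (trans (next-fromℕ m) (sym (opposite-fromℕ m)))

opposite-injective : {i j : Fin m} → opposite i ≡ opposite j → i ≡ j
opposite-injective {i = i} {j} p = trans (sym (opposite-involutive i)) (trans (cong opposite p) (opposite-involutive j))

-- Signed cycles in a Euclidean oriented matroid.

-- Reversing and negating cycles reduces to a = b = +, a directed cycle of (O, g, f).
record SignedCycle (O : OrientedMatroid n) (g f : Fin n) (a b : Sign) : Set where
  field
    {k}       : ℕ
    P         : Fin (suc k) → SV n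
    Z         : Fin (suc k) → SV n
    distinct  : ∀ i j → P i ≡ P j → i ≡ j
    P-g       : ∀ i → P i ! g ≡ a
    conformal : ∀ i → Conformal (P i) (P (next i))
    comodular : ∀ i → Comodular O (P i) (P (next i))
    elim      : ∀ i → Elim O (negV (P i)) (P (next i)) g (Z i)
    weak      : ∀ i → b *ₛ Z i ! f ≢ neg
    strict    : ∃[ i ] b *ₛ Z i ! f ≡ pos

module _ {O : OrientedMatroid n} {g f : Fin n} where

  open SignedCycle

  reverse-cycle : ∀ {a b} → SignedCycle O g f a b → SignedCycle O g f a (-ₛ b)
  reverse-cycle {a} {b} C = record
    { P = λ i → P C (opposite i)
    ; Z = λ i → negV (Z C (opposite (next i)))
    ; distinct = λ i j p → opposite-injective (distinct C _ _ p)
    ; P-g = λ i → P-g C (opposite i)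
    ; conformal = λ i → let j = opposite (next i) in
        subst (λ k → Conformal (P C k) (P C j)) (next-opposite-next i) (conformal-sym (P C j) (P C (next j)) (conformal C j))
    ; comodular = λ i → let j = opposite (next i) in
        subst (λ k → Comodular O (P C k) (P C j)) (next-opposite-next i) (comodular-sym O (comodular C j))
    ; elim = λ i → let j = opposite (next i) in
        subst (λ k → Elim O (negV (P C k)) (P C j) g (negV (Z C j))) (next-opposite-next i)
          (elim-swap O (P C j) (P C (next j)) {Z = Z C j} (elim C j))
    ; weak = λ i p → weak C (opposite (next i)) (trans (sym (sign (opposite (next i)))) p)
    -- Applying `opposite` after `next` twice returns `i`, so this is the index of the old edge `i`
    -- in the reversed cycle.
    ; strict = let i , p = strict C
                   j≡i = trans (cong opposite (next-opposite-next i)) (opposite-involutive i)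
               in opposite (next i) , trans (cong (λ k → (-ₛ b) *ₛ negV (Z C k) ! f) j≡i) (trans (sign i) p)
    }
    where
    sign : ∀ j → (-ₛ b) *ₛ negV (Z C j) ! f ≡ b *ₛ Z C j ! f
    sign j = trans (cong ((-ₛ b) *ₛ_) (!-negV (Z C j) f)) (-ₛ-*ₛ--ₛ b (Z C j ! f))

  negate-cycle : ∀ {a b} → SignedCycle O g f a b → SignedCycle O g f (-ₛ a) (-ₛ b)
  negate-cycle {a} {b} C = record
    { P = λ i → negV (P C i)
    ; Z = λ i → negV (Z C i)
    ; distinct = λ i j p → distinct C i j (negV-injective p)
    ; P-g = λ i → trans (!-negV (P C i) g) (cong -ₛ_ (P-g C i))
    ; conformal = λ i → conformal-neg (P C i) (P C (next i)) (conformal C i)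
    ; comodular = λ i → comodular-neg O (comodular C i)
    ; elim = λ i → elim-neg O (negV (P C i)) (P C (next i)) {Z = Z C i} (elim C i)
    ; weak = λ i p → weak C i (trans (sym (sign i)) p)
    ; strict = let i , p = strict C in i , trans (sign i) p
    }
    where
    sign : ∀ j → (-ₛ b) *ₛ negV (Z C j) ! f ≡ b *ₛ Z C j ! f
    sign j = trans (cong ((-ₛ b) *ₛ_) (!-negV (Z C j) f)) (-ₛ-*ₛ--ₛ b (Z C j ! f))

  -- The cocircuit supported on `f` alone has its support inside that of `X`, so it is `X` up to
  -- sign, and it vanishes at `g`.
  coloop-cocircuit : ∀ {X} → g ≢ f → Coloop O f → Cocircuit O X → X ! f ≢ zer → X ! g ≡ zer
  coloop-cocircuit {X} g≢f (C , (cC , C≢𝟎 , _) , supp≡) cX Xf =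
    [ (λ p → trans (cong (_! g) (sym p)) Cg) ,
      (λ p → -ₛ≡zer (trans (sym (!-negV X g)) (trans (cong (_! g) (sym p)) Cg))) ]′
    (support-unique O cX cC C≢𝟎 λ h Xh → C-off h λ { refl → Xf Xh })
    where
    C-off : ∀ h → h ≢ f → C ! h ≡ zer
    C-off h h≢f = lemma (C ! h) λ p → h≢f (x∈⁅y⁆⇒x≡y f (subst (h ∈_) supp≡
      (lookup⇒[]= h (supp C) (trans (lookup-map h _ C) p))))
      where
      lemma : ∀ s → ¬ (not (isZero s) ≡ true) → s ≡ zer
      lemma pos p = contradiction refl p
      lemma neg p = contradiction refl p
      lemma zer p = refl
    Cg : C ! g ≡ zer
    Cg = C-off g g≢f

  -- The cycle itself certifies the program: its vertices show that `g` is not a loop, and if `f`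
  -- were a coloop all vertices would vanish at `f`, hence so would the strict `Z`.
  no-positive-cycle : Euclidean O → g ≢ f → ¬ SignedCycle O g f pos pos
  no-positive-cycle euc g≢f C = euc g f (g≢f , g-not-loop , f-not-coloop) record
    { m = k C
    ; P = P C
    ; distinct = distinct C
    ; vertex = λ i → proj₁ (comodular C i) , P-g C i
    ; steps = λ i → subst (λ j → Step O g f (P C (inject₁ i)) (P C j)) (next-inject₁ i) (step′ (inject₁ i))
    ; closing = subst (λ j → Step O g f (P C (fromℕ _)) (P C j)) (next-fromℕ _) (step′ (fromℕ _))
    ; directed = next-elim
        (λ i j → Arrow O g f (P C i) (P C j) → (∃[ k ] Arrow O g f (P C (inject₁ k)) (P C (suc k))) ⊎ Arrow O g f (P C (fromℕ _)) (P C zero))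
        (λ i ar → inj₁ (i , ar)) inj₂ i₀ (Z C i₀ , elim C i₀ , Zf)
    }
    where
    i₀ = proj₁ (strict C)
    Zf : Z C i₀ ! f ≡ pos
    Zf = proj₂ (strict C)
    g-nonzero : ∀ i → P C i ! g ≢ zer
    g-nonzero i p = case trans (sym p) (P-g C i) of λ ()
    g-not-loop : ¬ Loop O g
    g-not-loop l = g-nonzero i₀ (l (P C i₀) (proj₁ (proj₁ (comodular C i₀))))
    f-not-coloop : ¬ Coloop O f
    f-not-coloop cl = case trans (sym Zf)
        (elim-above O (P C i₀) (P C (next i₀)) {Z = Z C i₀} (elim C i₀) f (f-zer i₀) (f-zer (next i₀))) of λ ()
      where
      f-zer : ∀ i → P C i ! f ≡ zer
      f-zer i = decidable-stable (P C i ! f ≟ zer) λ p →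
        g-nonzero i (coloop-cocircuit g≢f cl (proj₁ (comodular C i)) p)
    step′ : ∀ i → Step O g f (P C i) (P C (next i))
    step′ i with Z C i ! f in eq
    ... | pos = (conformal C i , comodular C i) , inj₁ (Z C i , elim C i , eq)
    ... | zer = (conformal C i , comodular C i) , inj₂ (Z C i , elim C i , eq)
    ... | neg = contradiction eq (weak C i)

  no-signed-cycle : Euclidean O → g ≢ f → ∀ {a b} → a ≢ zer → b ≢ zer → ¬ SignedCycle O g f a b
  no-signed-cycle euc g≢f {pos} {pos} _ _ C = no-positive-cycle euc g≢f C
  no-signed-cycle euc g≢f {pos} {neg} _ _ C = no-positive-cycle euc g≢f (reverse-cycle C)
  no-signed-cycle euc g≢f {neg} {neg} _ _ C = no-positive-cycle euc g≢f (negate-cycle C)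
  no-signed-cycle euc g≢f {neg} {pos} _ _ C = no-positive-cycle euc g≢f (reverse-cycle (negate-cycle C))
  no-signed-cycle euc g≢f {zer} p _ _ = p refl
  no-signed-cycle euc g≢f {_} {zer} _ p _ = p refl

-- Lexicographic signs on a family of sign vectors.

lexσ-zer : ∀ e a (I : List (Fin n × Sign)) Y → Y ! e ≡ zer → lexσ ((e , a) ∷ I) Y ≡ lexσ I Y
lexσ-zer e a I Y p with zer ← lookup Y e = refl

lexσ-nonzero : ∀ e a (I : List (Fin n × Sign)) Y → Y ! e ≢ zer → lexσ ((e , a) ∷ I) Y ≡ a *ₛ Y ! e
lexσ-nonzero e a I Y p with lookup Y e
... | pos = refl
... | neg = refl
... | zer = contradiction refl p

NonzeroSigns : List (Fin n × Sign) → Set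
NonzeroSigns = All (λ a → proj₂ a ≢ zer)

nonzero-somewhere? : (P : Fin m → SV n) → ∀ e → (∃[ i ] P i ! e ≢ zer) ⊎ (∀ i → P i ! e ≡ zer)
nonzero-somewhere? P e with any? (λ i → ¬? (P i ! e ≟ zer))
... | yes p = inj₁ p
... | no ∄i = inj₂ λ i → decidable-stable (P i ! e ≟ zer) λ p → ∄i (i , p)

-- Take the first element of `I` that is nonzero somewhere on the family. All earlier ones vanish on
-- the family, hence on `W`, and drop out of the lexicographic rule.
lex-leading : (I : List (Fin n × Sign)) → NonzeroSigns I → (P : Fin m → SV n) → (∃[ i ] lexσ I (P i) ≢ zer) →
  ∃[ e ] ∃[ a ] (a ≢ zer × (∃[ i ] P i ! e ≢ zer) ×
    (∀ W → (∀ h → (∀ i → P i ! h ≡ zer) → W ! h ≡ zer) → W ! e ≢ zer → lexσ I W ≡ a *ₛ W ! e))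
lex-leading [] _ P (_ , p) = contradiction refl p
lex-leading ((e , a) ∷ I) (a≢ ∷ I≢) P (i , p) with nonzero-somewhere? P e
... | inj₁ q = e , a , a≢ , q , λ W _ We → lexσ-nonzero e a I W We
... | inj₂ q with lex-leading I I≢ P (i , λ r → p (trans (lexσ-zer e a I (P i) (q i)) r))
... | e′ , a′ , a′≢ , q′ , dom = e′ , a′ , a′≢ , q′ , λ W ab We →
  trans (lexσ-zer e a I W (ab e q)) (dom W ab We)

-- The same choice of element transfers weak positivity, since entries that vanish there are
-- harmless. The given strict index may be one of those, so the new witness `k` is an index with a
-- nonzero entry.
lex-monotone : (I : List (Fin n × Sign)) → NonzeroSigns I → (Z : Fin m → SV n) → ∀ b →
  (∀ i → b *ₛ lexσ I (Z i) ≢ neg) → (∃[ i ] b *ₛ lexσ I (Z i) ≡ pos) →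
  ∃[ e ] ∃[ a ] (a ≢ zer × (∀ i → (b *ₛ a) *ₛ Z i ! e ≢ neg) × (∃[ i ] (b *ₛ a) *ₛ Z i ! e ≡ pos))
lex-monotone [] _ Z b _ (_ , p) = case trans (sym p) (*ₛ-zerʳ b) of λ ()
lex-monotone ((e , a) ∷ I) (a≢ ∷ I≢) Z b weak (i , p) with nonzero-somewhere? Z e
... | inj₂ q = lex-monotone I I≢ Z b
      (λ j r → weak j (trans (cong (b *ₛ_) (lexσ-zer e a I (Z j) (q j))) r))
      (i , trans (cong (b *ₛ_) (sym (lexσ-zer e a I (Z i) (q i)))) p)
... | inj₁ (k , Zk) = e , a , a≢ , weak′ , k , positive
  where
  b≢zer : b ≢ zer
  b≢zer refl = case p of λ ()
  scaled : ∀ j → Z j ! e ≢ zer → (b *ₛ a) *ₛ Z j ! e ≡ b *ₛ lexσ ((e , a) ∷ I) (Z j)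
  scaled j q = trans (*ₛ-assoc b a (Z j ! e)) (cong (b *ₛ_) (sym (lexσ-nonzero e a I (Z j) q)))
  weak′ : ∀ j → (b *ₛ a) *ₛ Z j ! e ≢ neg
  weak′ j r with Z j ! e ≟ zer
  ... | yes q = case trans (sym r) (trans (cong ((b *ₛ a) *ₛ_) q) (*ₛ-zerʳ (b *ₛ a))) of λ ()
  ... | no q = weak j (trans (sym (scaled j q)) r)
  positive : (b *ₛ a) *ₛ Z k ! e ≡ pos
  positive = ≢neg⇒≡pos (*ₛ-nonzero (*ₛ-nonzero b≢zer a≢) Zk) (weak′ k)

-- Refuting a directed cycle of the extension.

module ExtCycle (O : OrientedMatroid n) (euc : Euclidean O) (I : List (Fin n × Sign)) (I≢ : NonzeroSigns I)
  (Õ : OrientedMatroid (suc n)) (ext : IsExtension Õ O (lexσ I)) (no-coloop : ¬ Cov Õ (pos ∷ 𝟎)) (f : Fin n)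
  (Q : Fin (suc m) → SV n) (distinct : ∀ i j → Q i ≡ Q j → i ≡ j)
  (cf : ∀ i → Conformal (pos ∷ Q i) (pos ∷ Q (next i)))
  (cm : ∀ i → Comodular Õ (pos ∷ Q i) (pos ∷ Q (next i)))
  (Z : Fin (suc m) → SV n)
  (el : ∀ i → Elim Õ (negV (pos ∷ Q i)) (pos ∷ Q (next i)) zero (zer ∷ Z i))
  (weak : ∀ i → Z i ! f ≢ neg)
  -- The arrow brings its own eliminated cocircuit, which is kept apart from `Z i₀`.
  (i₀ : Fin (suc m)) (Z₀ : SV n)
  (el₀ : Elim Õ (negV (pos ∷ Q i₀)) (pos ∷ Q (next i₀)) zero (zer ∷ Z₀))
  (strict : Z₀ ! f ≡ pos)
  where

  open Extension O Õ (lexσ I) ext no-coloop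

  -- Going forward, `pos` cannot become `neg` by conformality, nor `zer` since `Z i` would then be
  -- `neg` at `f`; dually `neg` persists going backward. If neither sign occurs, `Z₀` vanishes at
  -- `f`.
  f-constant : ∃[ c ] (c ≢ zer × ∀ i → Q i ! f ≡ c)
  f-constant with any? (λ i → Q i ! f ≟ pos) | any? (λ i → Q i ! f ≟ neg)
  ... | yes (i , p) | _ = pos , (λ ()) , cyclic-induction (λ i → Q i ! f ≡ pos) forward i p
    where
    forward : ∀ i → Q i ! f ≡ pos → Q (next i) ! f ≡ pos
    forward i p with Q (next i) ! f ≟ zer
    ... | yes q = contradiction (trans (Edge.elim-at-X-only Õ (cf i) (cm i) {zero} (λ ()) refl {zer ∷ Z i} (el i) (suc f)
                    (λ r → case trans (sym p) r of λ ()) q) (cong -ₛ_ p)) (weak i)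
    ... | no q = trans (sym (conformal-≡ (pos ∷ Q i) (pos ∷ Q (next i)) (cf i) (suc f) (λ r → case trans (sym p) r of λ ()) q)) p
  ... | no _ | yes (i , p) = neg , (λ ()) , cyclic-induction⁻ (λ i → Q i ! f ≡ neg) backward i p
    where
    backward : ∀ i → Q (next i) ! f ≡ neg → Q i ! f ≡ neg
    backward i p with Q i ! f ≟ zer
    ... | yes q = contradiction (trans (elim-at-Y-only Õ (cf i) (cm i) {zero} (λ ()) refl {zer ∷ Z i} (el i) (suc f)
                    (λ r → case trans (sym p) r of λ ()) q) p) (weak i)
    ... | no q = trans (conformal-≡ (pos ∷ Q i) (pos ∷ Q (next i)) (cf i) (suc f) q (λ r → case trans (sym p) r of λ ())) p
  ... | no ∄pos | no ∄neg = case trans (sym strict)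
        (elim-above Õ (pos ∷ Q i₀) (pos ∷ Q (next i₀)) {zero} {zer ∷ Z₀} el₀ (suc f) (f-zer i₀) (f-zer (next i₀))) of λ ()
    where
    f-zer : ∀ i → Q i ! f ≡ zer
    f-zer i with Q i ! f in eq
    ... | pos = contradiction (i , eq) ∄pos
    ... | neg = contradiction (i , eq) ∄neg
    ... | zer = refl

  private
    c = proj₁ f-constant
    c≢zer = proj₁ (proj₂ f-constant)
    Q-f : ∀ i → Q i ! f ≡ c
    Q-f = proj₂ (proj₂ f-constant)
    Q-f≢zer : ∀ i → Q i ! f ≢ zer
    Q-f≢zer i p = c≢zer (trans (sym (Q-f i)) p)
    Q-f≡ : ∀ i → Q i ! f ≡ Q (next i) ! f
    Q-f≡ i = trans (Q-f i) (sym (Q-f (next i)))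

    Q-cocircuit : ∀ i → Cocircuit O (Q i)
    Q-cocircuit i = vertex-cocircuit (proj₁ (cm i))

    Q-σ : ∀ i → lexσ I (Q i) ≡ pos
    Q-σ i = sym (lift-σ (Q-cocircuit i) (proj₁ (proj₁ (cm i))))

    module Leading {e a} (a≢zer : a ≢ zer) (k : ∃[ i ] Q i ! e ≢ zer)
      (dominant : ∀ W → (∀ h → (∀ i → Q i ! h ≡ zer) → W ! h ≡ zer) → W ! e ≢ zer → lexσ I W ≡ a *ₛ W ! e) where

      dominant-edge : ∀ i W → Above (Q i) (Q (next i)) W → W ! e ≢ zer → lexσ I W ≡ a *ₛ W ! e
      dominant-edge i W ab = dominant W λ h p → ab h (p i) (p (next i))

      Q-e : ∀ i → Q i ! e ≢ zer → Q i ! e ≡ a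
      Q-e i p = *ₛ≡pos⇒≡ (trans (sym (dominant (Q i) (λ h q → q i) p)) (Q-σ i))

      module At (i : Fin (suc m)) {Z} (el : Elim Õ (negV (pos ∷ Q i)) (pos ∷ Q (next i)) zero (zer ∷ Z)) =
        ExtEdge (cf i) (cm i) a≢zer (dominant-edge i) {Z} el

      -- The same edge traversed backwards, so that `leaving` also covers edges entering `e ≠ 0`.
      module At⁻ (i : Fin (suc m)) =
        ExtEdge (conformal-sym (pos ∷ Q i) (pos ∷ Q (next i)) (cf i)) (comodular-sym Õ (cm i)) a≢zer
          (λ W ab → dominant-edge i W (λ h p q → ab h q p)) {negV (Z i)}
          (elim-swap Õ (pos ∷ Q i) (pos ∷ Q (next i)) {zero} {zer ∷ Z i} (el i))

      -- A cycle meeting both e = 0 and e ≠ 0 has a decreasing edge: the one leaving e ≠ 0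
      -- if c = −, the one entering it if c = +.
      Q-e-constant : ∀ i → Q i ! e ≡ a
      Q-e-constant with c in c≡
      ... | zer = contradiction c≡ c≢zer
      ... | neg = cyclic-induction (λ i → Q i ! e ≡ a) forward (proj₁ k) (Q-e _ (proj₂ k))
        where
        forward : ∀ i → Q i ! e ≡ a → Q (next i) ! e ≡ a
        forward i p = Q-e (next i) λ q → weak i
          (trans (At.leaving i (el i) p q f (Q-f≢zer (next i))) (trans (Q-f (next i)) c≡))
      ... | pos = cyclic-induction⁻ (λ i → Q i ! e ≡ a) backward (proj₁ k) (Q-e _ (proj₂ k))
        where
        backward : ∀ i → Q (next i) ! e ≡ a → Q i ! e ≡ a
        backward i p = Q-e i λ q → weak i
          (trans (sym (-ₛ-involutive (Z i ! f))) (cong -ₛ_ (trans (sym (!-negV (Z i) f))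
            (trans (At⁻.leaving i p q f (Q-f≢zer i)) (trans (Q-f i) c≡)))))

      cf′ : ∀ i → Conformal (Q i) (Q (next i))
      cf′ i h = cf i (suc h)

      cm′ : ∀ i → Comodular O (Q i) (Q (next i))
      cm′ i = comodular-delete (cf i) (cm i)

      elim′ : ∀ i → ∃[ Z′ ] Elim O (negV (Q i)) (Q (next i)) e Z′
      elim′ i = Edge.elim-exists O (cf′ i) (cm′ i) (λ p → a≢zer (trans (sym (Q-e-constant i)) p))
        (trans (Q-e-constant i) (sym (Q-e-constant (next i))))

      Z′ : Fin (suc m) → SV n
      Z′ i = proj₁ (elim′ i)

      -- Constancy of `f` puts the fixed factor `-ₛ c` in front of the localization, the shape that
      -- `lex-monotone` takes.
      affine′ : ∀ i {Z} → Elim Õ (negV (pos ∷ Q i)) (pos ∷ Q (next i)) zero (zer ∷ Z) →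
        Z ! f ≡ Z′ i ! f ∘ₛ ((-ₛ c) *ₛ lexσ I (Z′ i))
      affine′ i {Z} el = trans (At.affine i {Z} el (Q-e-constant i) (Q-e-constant (next i)) {Z′ i} (proj₂ (elim′ i)) f (Q-f≢zer i) (Q-f≡ i))
        (cong (Z′ i ! f ∘ₛ_) (trans (-ₛ-*ₛ-comm (lexσ I (Z′ i)) (Q i ! f)) (cong (λ x → (-ₛ x) *ₛ lexσ I (Z′ i)) (Q-f i))))

      no-monotone : ∀ h b → b ≢ zer → (∀ i → b *ₛ Z′ i ! h ≢ neg) → (∃[ i ] b *ₛ Z′ i ! h ≡ pos) → ⊥
      no-monotone h b b≢zer wk st@(i , p) = no-signed-cycle euc e≢h a≢zer b≢zer record
        { P = Q
        ; Z = Z′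
        ; distinct = distinct
        ; P-g = Q-e-constant
        ; conformal = cf′
        ; comodular = cm′
        ; elim = λ i → proj₂ (elim′ i)
        ; weak = wk
        ; strict = st
        }
        where
        e≢h : e ≢ h
        e≢h refl = case trans (sym p) (trans (cong (b *ₛ_) (proj₁ (proj₂ (proj₂ (elim′ i))))) (*ₛ-zerʳ b)) of λ ()

      impossible : ⊥
      impossible with nonzero-somewhere? Z′ f
      ... | inj₁ (i , Z′f) = no-monotone f pos (λ ()) weak′ (i , ≢neg⇒≡pos Z′f (weak′ i))
        where
        weak′ : ∀ j → Z′ j ! f ≢ neg
        weak′ j p = weak j (trans (affine′ j (el j)) (cong (_∘ₛ ((-ₛ c) *ₛ lexσ I (Z′ j))) p))
      ... | inj₂ Z′f
        with lex-monotone I I≢ Z′ (-ₛ c)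
               (λ i p → weak i (trans (affine′ i (el i)) (trans (∘ₛ-zerˡ (Z′f i)) p)))
               (i₀ , trans (sym (∘ₛ-zerˡ (Z′f i₀))) (trans (sym (affine′ i₀ el₀)) strict))
      ... | h , b , b≢zer , wk , st =
        no-monotone h ((-ₛ c) *ₛ b) (*ₛ-nonzero (λ p → c≢zer (-ₛ≡zer p)) b≢zer) wk st

  no-cycle : ⊥
  no-cycle with e , a , a≢ , k , dominant ← lex-leading I I≢ Q (zero , λ p → case trans (sym p) (Q-σ zero) of λ ()) =
    Leading.impossible a≢ k dominant

-- The coloop case and the final assembly.

pos-head : (V : SV (suc n)) → V ! zero ≡ pos → V ≡ pos ∷ tail V
pos-head (_ ∷ _) refl = refl

-- IsExtension does not exclude that p is a coloop; pos ∷ 𝟎 is then the only vertex.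
no-cycle-coloop : (Õ : OrientedMatroid (suc n)) (f : Fin (suc n)) → Cov Õ (pos ∷ 𝟎) → EuclideanProgram Õ zero f
no-cycle-coloop Õ f c C with (_ , (_ , _ , P≢ , _)) , _ ← DirectedCycle.closing C =
  P≢ (trans (vertex≡ (fromℕ _)) (sym (vertex≡ zero)))
  where
  open DirectedCycle C using (P; vertex)
  vertex≡ : ∀ i → P i ≡ pos ∷ 𝟎
  vertex≡ i with (_ , _ , min) , p₀ ← vertex i =
    sym (min (pos ∷ 𝟎) c (λ ()) λ { zero → subst (pos ≼_) (sym p₀) refl≼
                                  ; (suc e) → subst (_≼ P i ! suc e) (sym (!-𝟎 e)) zer≼ })

theorem1p1 : ∀ {n} (O : OrientedMatroid n) → Euclidean O →
    (I : List (Fin n × Sign)) → Unique (map proj₁ I) →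
    All (λ a → proj₂ a ≢ zer) I →
    (Õ : OrientedMatroid (suc n)) → IsExtension Õ O (lexσ I) →
    (f : Fin n) → Program Õ zero (suc f) → EuclideanProgram Õ zero (suc f)
-- `Cov` is an arbitrary predicate, so there is no deciding whether p is a coloop; as the goal is
-- absurdity, both answers are refuted.
theorem1p1 {n} O euc I _ I≢ Õ ext f _ C = no-coloop λ c → no-cycle-coloop Õ (suc f) c C
  where
  open DirectedCycle C renaming (m to last)
  Q : Fin (suc last) → SV n
  Q i = tail (P i)
  P≡ : ∀ i → P i ≡ pos ∷ Q i
  P≡ i = pos-head (P i) (proj₂ (vertex i))
  step-Q : ∀ i → Step Õ zero (suc f) (pos ∷ Q i) (pos ∷ Q (next i))
  step-Q i = subst₂ (Step Õ zero (suc f)) (P≡ i) (P≡ (next i))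
    (next-elim (λ i j → Step Õ zero (suc f) (P i) (P j)) steps closing i)
  elim-Q : ∀ i → ∃[ Z ] (Elim Õ (negV (pos ∷ Q i)) (pos ∷ Q (next i)) zero (zer ∷ Z) × Z ! f ≢ neg)
  elim-Q i with proj₂ (step-Q i)
  ... | inj₁ ((zer ∷ Z) , el@(_ , refl , _) , Zf) = Z , el , λ p → case trans (sym p) Zf of λ ()
  ... | inj₂ ((zer ∷ Z) , el@(_ , refl , _) , Zf) = Z , el , λ p → case trans (sym p) Zf of λ ()
  arrow : ∃[ i ] Arrow Õ zero (suc f) (P i) (P (next i))
  arrow = [ (λ (i , ar) → inject₁ i , subst (λ j → Arrow Õ zero (suc f) (P (inject₁ i)) (P j)) (sym (next-inject₁ i)) ar) ,
            (λ ar → fromℕ last , subst (λ j → Arrow Õ zero (suc f) (P (fromℕ last)) (P j)) (sym (next-fromℕ last)) ar) ]′ directed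
  no-coloop : ¬ ¬ Cov Õ (pos ∷ 𝟎)
  no-coloop ¬c with i₀ , ar ← arrow
    with subst₂ (Arrow Õ zero (suc f)) (P≡ i₀) (P≡ (next i₀)) ar
  ... | (zer ∷ Z₀) , el₀@(_ , refl , _) , Z₀f =
    ExtCycle.no-cycle O euc I I≢ Õ ext ¬c f Q
      (λ i j p → distinct i j (trans (P≡ i) (trans (cong (pos ∷_) p) (sym (P≡ j)))))
      (λ i → proj₁ (proj₁ (step-Q i))) (λ i → proj₂ (proj₁ (step-Q i)))
      (λ i → proj₁ (elim-Q i)) (λ i → proj₁ (proj₂ (elim-Q i))) (λ i → proj₂ (proj₂ (elim-Q i)))
      i₀ Z₀ el₀ Z₀f
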